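{- There exists a sentence $\varphi$ of ${\rm FO}(\rightarrow)$ using only two individual variables (variables may be reused/requantified) such that the following problem is undecidable: given a Petri net $N$, decide whether $(\mathrm{Reach}(N),\rightarrow)\models\varphi$.
   Context: A Petri net is $N=(P,T,F,M_0)$ with finite disjoint sets $P$ (places) and $T$ (transitions), $F:(P\times T)\cup(T\times P)\to\mathbb{N}$, and initial marking $M_0:P\to\mathbb{N}$. A marking is a function $M:P\to\mathbb{N}$. A transition $t$ is enabled at $M$ if $M(p)\ge F(p,t)$ for all $p$; firing it yields $M'$ with $M'(p)=M(p)+F(t,p)-F(p,t)$. $\mathrm{Reach}(N)$ is the set of markings reachable from $M_0$. $M\rightarrow M'$ means $M'$ is obtained from $M$ by firing some transition of $N$. ${\rm FO}(\rightarrow)$ is first-order logic whose only atomic formulas are $x\rightarrow y$, interpreted in the structure $(\mathrm{Reach}(N),\rightarrow)$. -}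

module Defs where

open import Data.Nat using (ℕ; zero; suc; _+_; _∸_; _≤_; _<_)
open import Data.Fin using (Fin; _≟_)
open import Data.Vec using (Vec; []; _∷_; lookup; zipWith)
open import Data.List using (List; []; _∷_)
open import Data.List.Relation.Unary.Any using (Any)
open import Data.Product using (Σ; _×_; _,_; proj₁)
open import Data.Sum using (_⊎_)
open import Data.Bool using (Bool; true; false)
open import Relation.Nullary using (¬_; yes; no)
open import Relation.Binary.PropositionalEquality using (_≡_)

-- Petri nets.  Places are Fin k; transitions are the (finite) list
-- `trans`, each given by its pre-vector F(·,t) and post-vector F(t,·).

record PetriNet : Set where
  field
    places : ℕ
    trans  : List (Vec ℕ places × Vec ℕ places)   -- (pre , post)
    init   : Vec ℕ places

Marking : ℕ → Set
Marking k = Vec ℕ k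

module _ {k : ℕ} where
  Enabled : Vec ℕ k × Vec ℕ k → Marking k → Set
  Enabled (pre , post) M = (p : Fin k) → lookup pre p ≤ lookup M p

  fire : Vec ℕ k × Vec ℕ k → Marking k → Marking k
  fire (pre , post) M = zipWith _+_ (zipWith _∸_ M pre) post

Step : (N : PetriNet) → Marking (PetriNet.places N) → Marking (PetriNet.places N) → Set
Step N M M' = Any (λ t → Enabled t M × M' ≡ fire t M) (PetriNet.trans N)

data Reachable (N : PetriNet) : Marking (PetriNet.places N) → Set where
  here : Reachable N (PetriNet.init N)
  step : ∀ {M M'} → Reachable N M → Step N M M' → Reachable N M'

Reach : PetriNet → Set
Reach N = Σ (Marking (PetriNet.places N)) (Reachable N)

Var : Set
Var = Fin 2

data Formula : Set where
  edge      : Var → Var → Formula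
  ¬'_       : Formula → Formula
  _∧'_ _∨'_ : Formula → Formula → Formula
  ∃'_∙_ ∀'_∙_ : Var → Formula → Formula

Bound : Set
Bound = Var → Bool

bind : Bound → Var → Bound
bind β x y with x ≟ y
... | yes _ = true
... | no  _ = β y

data Scoped (β : Bound) : Formula → Set where
  edge : ∀ {x y} → β x ≡ true → β y ≡ true → Scoped β (edge x y)
  neg  : ∀ {φ} → Scoped β φ → Scoped β (¬' φ)
  and  : ∀ {φ ψ} → Scoped β φ → Scoped β ψ → Scoped β (φ ∧' ψ)
  or   : ∀ {φ ψ} → Scoped β φ → Scoped β ψ → Scoped β (φ ∨' ψ)
  ex   : ∀ {x φ} → Scoped (bind β x) φ → Scoped β (∃' x ∙ φ)
  all  : ∀ {x φ} → Scoped (bind β x) φ → Scoped β (∀' x ∙ φ)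

Sentence : Formula → Set
Sentence = Scoped (λ _ → false)

update : {A : Set} → (Var → A) → Var → A → (Var → A)
update ρ x a y with x ≟ y
... | yes _ = a
... | no  _ = ρ y

Sat : (N : PetriNet) → (Var → Reach N) → Formula → Set
Sat N ρ (edge x y) = Step N (proj₁ (ρ x)) (proj₁ (ρ y))
Sat N ρ (¬' φ)     = ¬ Sat N ρ φ
Sat N ρ (φ ∧' ψ)   = Sat N ρ φ × Sat N ρ ψ
Sat N ρ (φ ∨' ψ)   = Sat N ρ φ ⊎ Sat N ρ ψ
Sat N ρ (∃' x ∙ φ) = Σ (Reach N) λ m → Sat N (update ρ x m) φ
Sat N ρ (∀' x ∙ φ) = (m : Reach N) → Sat N (update ρ x m) φ

-- (Reach(N), →) ⊨ φ   (for sentences the assignment is irrelevant;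
-- Reach(N) is nonempty since it contains M₀)
_⊨_ : PetriNet → Formula → Set
N ⊨ φ = Sat N (λ _ → (PetriNet.init N , here)) φ

data PR : ℕ → Set
data PRs : ℕ → ℕ → Set

data PR where
  zeroF : ∀ {n} → PR n
  succF : PR 1
  proj  : ∀ {n} → Fin n → PR n
  comp  : ∀ {m n} → PR m → PRs m n → PR n
  prec  : ∀ {n} → PR n → PR (suc (suc n)) → PR (suc n)
  mu    : ∀ {n} → PR (suc n) → PR n

data PRs where
  []  : ∀ {n} → PRs 0 n
  _∷_ : ∀ {m n} → PR n → PRs m n → PRs (suc m) n

data Eval : ∀ {n} → PR n → Vec ℕ n → ℕ → Set
data Evals : ∀ {m n} → PRs m n → Vec ℕ n → Vec ℕ m → Set

data Eval where
  zeroE : ∀ {n} {xs : Vec ℕ n} → Eval zeroF xs 0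
  succE : ∀ {x} → Eval succF (x ∷ []) (suc x)
  projE : ∀ {n} {i : Fin n} {xs} → Eval (proj i) xs (lookup xs i)
  compE : ∀ {m n} {f : PR m} {gs : PRs m n} {xs ys y} →
          Evals gs xs ys → Eval f ys y → Eval (comp f gs) xs y
  prec0 : ∀ {n} {g : PR n} {h xs y} → Eval g xs y → Eval (prec g h) (0 ∷ xs) y
  precS : ∀ {n} {g : PR n} {h xs k r y} →
          Eval (prec g h) (k ∷ xs) r → Eval h (k ∷ r ∷ xs) y →
          Eval (prec g h) (suc k ∷ xs) y
  muE   : ∀ {n} {f : PR (suc n)} {xs y} →
          Eval f (y ∷ xs) 0 →
          ((z : ℕ) → z < y → Σ ℕ λ v → Eval f (z ∷ xs) (suc v)) →
          Eval (mu f) xs y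

data Evals where
  []  : ∀ {n} {xs : Vec ℕ n} → Evals [] xs []
  _∷_ : ∀ {m n} {g : PR n} {gs : PRs m n} {xs y ys} →
        Eval g xs y → Evals gs xs ys → Evals (g ∷ gs) xs (y ∷ ys)

-- Standard Gödel encoding of Petri nets into ℕ (Cantor pairing).

tri : ℕ → ℕ
tri zero    = zero
tri (suc n) = suc n + tri n

pair : ℕ → ℕ → ℕ
pair x y = tri (x + y) + y

codeVec : ∀ {k} → Vec ℕ k → ℕ
codeVec []       = 0
codeVec (x ∷ xs) = suc (pair x (codeVec xs))

codeTrans : ∀ {k} → List (Vec ℕ k × Vec ℕ k) → ℕ
codeTrans []                = 0
codeTrans ((pre , post) ∷ ts) = suc (pair (pair (codeVec pre) (codeVec post)) (codeTrans ts))

codeNet : PetriNet → ℕ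
codeNet N = pair (PetriNet.places N) (pair (codeTrans (PetriNet.trans N)) (codeVec (PetriNet.init N)))

DecidableNetProperty : (PetriNet → Set) → Set
DecidableNetProperty P =
  Σ (PR 1) λ c → (N : PetriNet) →
    (P N → Eval c (codeNet N ∷ []) 1) × (¬ P N → Eval c (codeNet N ∷ []) 0)

{-# OPTIONS --safe #-}
module Submission where

-- Let p₀ be a counter program applying a supposed decider to the code of the very net built from p₀.
-- That code is computable from the inputs of p₀: the inputs are the initial tokens of three places,
-- and they are chosen to be the codes of the other parts of the net.
--
-- The net chooses between two kinds of run.  An active run guesses a register bound b, a number c of
-- zero tests and a volume v, then simulates p₀ with every register r accompanied by a coregister,
-- the two summing to b.  A zero test of r moves b tokens from the coregister to r and b tokens back,
-- at one unit of fuel per token; if r is positive fewer moves are possible.  The fuel is 2v, so a run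
-- that uses up all its tests and all its fuel although v ≥ bc has made honest tests only.  A passive
-- run is a weak multiplication: it reaches exactly the final markings in which v ≤ bc.
-- Since accepting increments v, a final marking that is reached actively but not passively, without
-- leftover tests, fuel and inputs, witnesses an honest accepting run.  Transitions with no effect
-- make this a property in two variables: active markings and those with leftovers carry a self-loop,
-- so the formula `trap` below asks for a marking without a self-loop all of whose predecessors have one.

open import Defs
open import Data.Bool using (if_then_else_)
open import Data.Empty using (⊥; ⊥-elim)
open import Data.Fin using (Fin; zero; suc; toℕ; fromℕ<; _↑ʳ_; _↑ˡ_; #_)
import Data.Fin as Fin
open import Data.Fin.Properties using (toℕ<n; toℕ-fromℕ<)
open import Data.List using (List; []; _∷_; _++_; concatMap; upTo; allFin; length) renaming (map to mapᴸ; lookup to lookupᴸ)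
open import Data.List.Membership.Propositional using (_∈_; lose; find)
open import Data.List.Membership.Propositional.Properties using (∈-++⁺ˡ; ∈-++⁺ʳ; ∈-++⁻; ∈-map⁺; ∈-map⁻; ∈-concatMap⁺; ∈-upTo⁺; ∈-allFin; ∈-lookup)
open import Data.List.Relation.Unary.All as All using (All; []; _∷_)
import Data.List.Relation.Unary.All.Properties as Allₚ
open import Data.List.Relation.Unary.Any using (here; there)
import Data.List.Relation.Unary.Any.Properties as Anyₚ
open import Data.Maybe using (Maybe; just; nothing; fromMaybe)
open import Data.Nat using (ℕ; zero; suc; _+_; _*_; _∸_; _≤_; _<_; z≤n; s≤s; _⊔_)
import Data.Nat as ℕ
open import Data.Nat.ListAction using (sum)
open import Data.Nat.Properties hiding (_≟_)
open import Data.Nat.Solver using (module +-*-Solver)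
open import Data.Product using (Σ; ∃-syntax; ∃₂; _×_; _,_; proj₁; proj₂)
open import Data.Product.Properties using (≡-dec)
open import Data.Sum using (_⊎_; inj₁; inj₂)
open import Data.Unit using (⊤; tt)
open import Data.Vec using (Vec; []; _∷_; head; tail; lookup; map; tabulate; fromList; replicate; _[_]≔_; _[_]%=_) renaming (_++_ to _++ᵛ_)
import Data.Vec.Membership.Propositional as Vec∈
open import Data.Vec.Membership.Propositional.Properties using (∈-fromList⁺)
open import Data.Vec.Properties using ([]≔-lookup; updateAt-updateAt; lookup-++ˡ; lookup-++ʳ; lookup∘update; lookup∘update′; lookup-map; lookup-replicate; tabulate-∘; tabulate∘lookup; tabulate-cong; map-cong; map-∘)
open import Data.Vec.Relation.Unary.Any using (index) renaming (here to hereᵛ; there to thereᵛ)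
open import Data.Vec.Relation.Unary.Any.Properties using (lookup-index)
open import Function using (_∘_; id)
open import Relation.Binary.Definitions using (DecidableEquality)
open import Relation.Binary.PropositionalEquality using (_≡_; _≢_; _≗_; refl; sym; trans; cong; cong₂; subst; subst₂; module ≡-Reasoning)
open import Relation.Nullary using (¬_; Dec; yes; no; does)

-- Counter programs

δ : ℕ → ℕ → ℕ
δ zero    zero    = 1
δ zero    (suc _) = 0
δ (suc _) zero    = 0
δ (suc r) (suc j) = δ r j

δ-refl : ∀ r → δ r r ≡ 1
δ-refl zero    = refl
δ-refl (suc r) = δ-refl r

δ-dichotomy : ∀ r j → δ r j ≡ 0 ⊎ r ≡ j
δ-dichotomy zero    zero    = inj₂ refl
δ-dichotomy zero    (suc j) = inj₁ refl
δ-dichotomy (suc r) zero    = inj₁ refl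
δ-dichotomy (suc r) (suc j) with δ-dichotomy r j
... | inj₁ eq = inj₁ eq
... | inj₂ eq = inj₂ (cong suc eq)

δ-> : ∀ {r j} → j < r → δ r j ≡ 0
δ-> {r} {j} j<r with δ-dichotomy r j
... | inj₁ eq = eq
... | inj₂ refl = ⊥-elim (<-irrefl refl j<r)

δ-< : ∀ {r j} → r < j → δ r j ≡ 0
δ-< {r} {j} r<j with δ-dichotomy r j
... | inj₁ eq = eq
... | inj₂ refl = ⊥-elim (<-irrefl refl r<j)

δ-≤ : ∀ {r} (f : ℕ → ℕ) → 1 ≤ f r → ∀ j → δ r j ≤ f j
δ-≤ {r} f 1≤ j with δ-dichotomy r j
... | inj₁ eq   = subst (_≤ f j) (sym eq) z≤n
... | inj₂ refl = subst (_≤ f r) (sym (δ-refl r)) 1≤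

State : Set
State = ℕ → ℕ

infixr 6 _∔_
_∔_ : State → State → State
(f ∔ g) j = f j + g j

-- `while r p q` means: while register r is nonzero, decrement it and run p; then run q.
data Prog : Set where
  nil   : Prog
  inc   : ℕ → Prog → Prog
  while : ℕ → Prog → Prog → Prog

infixr 5 _⨟_
_⨟_ : Prog → Prog → Prog
nil         ⨟ k = k
inc r p     ⨟ k = inc r (p ⨟ k)
while r p q ⨟ k = while r p (q ⨟ k)

⨟-identityʳ : ∀ p → p ⨟ nil ≡ p
⨟-identityʳ nil           = refl
⨟-identityʳ (inc r p)     = cong (inc r) (⨟-identityʳ p)
⨟-identityʳ (while r p q) = cong (while r p) (⨟-identityʳ q)

⨟-assoc : ∀ p q k → (p ⨟ q) ⨟ k ≡ p ⨟ (q ⨟ k)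
⨟-assoc nil           q k = refl
⨟-assoc (inc r p)     q k = cong (inc r) (⨟-assoc p q k)
⨟-assoc (while r b p) q k = cong (while r b) (⨟-assoc p q k)

-- States are functions, so `iter` relates the state before and after the decrement only pointwise.
-- The two loop rules exclude each other, whence determinism.
data Run : Prog → State → State → Set where
  nil  : ∀ {s} → Run nil s s
  inc  : ∀ {r p s t} → Run p (δ r ∔ s) t → Run (inc r p) s t
  exit : ∀ {r p q s t} → s r ≡ 0 → Run q s t → Run (while r p q) s t
  iter : ∀ {r p q s s′ t} → s ≗ δ r ∔ s′ → Run (p ⨟ while r p q) s′ t → Run (while r p q) s t

⨟-run : ∀ {p q s t u} → Run p s t → Run q t u → Run (p ⨟ q) s u
⨟-run nil               run′ = run′
⨟-run (inc run)         run′ = inc (⨟-run run run′)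
⨟-run (exit s≡0 run)    run′ = exit s≡0 (⨟-run run run′)
⨟-run (iter {r} {p} {q} s≗ run) run′ =
  iter s≗ (subst (λ k → Run k _ _) (⨟-assoc p (while r p q) _) (⨟-run run run′))

exit-iter-⊥ : ∀ {r} {s s₁ s₂ : State} → s ≗ s₁ → s r ≡ 0 → s₁ ≗ δ r ∔ s₂ → ⊥
exit-iter-⊥ {r} {s} {s₁} {s₂} s≗ s≡0 s₁≗ =
  0≢1+n (trans (sym s≡0) (trans (s≗ r) (trans (s₁≗ r) (cong (_+ s₂ r) (δ-refl r)))))

Run-deterministic : ∀ {p s s′ t t′} → s ≗ s′ → Run p s t → Run p s′ t′ → t ≗ t′
Run-deterministic s≗ nil nil = s≗
Run-deterministic s≗ (inc {r} run) (inc run′) =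
  Run-deterministic (λ j → cong (δ r j +_) (s≗ j)) run run′
Run-deterministic s≗ (exit _ run) (exit _ run′) = Run-deterministic s≗ run run′
Run-deterministic s≗ (exit s≡0 _) (iter s′≗ _) = ⊥-elim (exit-iter-⊥ s≗ s≡0 s′≗)
Run-deterministic s≗ (iter s₁≗ _) (exit s≡0 _) = ⊥-elim (exit-iter-⊥ (sym ∘ s≗) s≡0 s₁≗)
Run-deterministic s≗ (iter {r} s₁≗ run) (iter s₂≗ run′) =
  Run-deterministic (λ j → +-cancelˡ-≡ (δ r j) _ _ (trans (sym (s₁≗ j)) (trans (s≗ j) (s₂≗ j)))) run run′

-- Compiling recursive functions

-- A stack lives in the registers below its height, the bottom in register 0.  The junk value 0
-- of every other register makes pushing a 0, or popping one, invisible: get (0 ∷ st) is get st.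
get : ∀ {h} → Vec ℕ h → State
get []                 j = 0
get {suc h} (x ∷ st) j = x * δ h j + get st j

cell : ∀ {h} → Fin h → ℕ
cell {suc h} zero    = h
cell {suc h} (suc i) = cell i

cell-< : ∀ {h} (i : Fin h) → cell i < h
cell-< {suc h} zero    = ≤-refl
cell-< {suc h} (suc i) = m<n⇒m<1+n (cell-< i)

get-high : ∀ {h} (st : Vec ℕ h) {j} → h ≤ j → get st j ≡ 0
get-high []       h≤j = refl
get-high (x ∷ st) h<j rewrite δ-< h<j | get-high st (<⇒≤ h<j) | *-zeroʳ x = refl

get-cell : ∀ {h} (st : Vec ℕ h) i → get st (cell i) ≡ lookup st i
get-cell {suc h} (x ∷ st) zero rewrite δ-refl h | get-high st ≤-refl | *-identityʳ x = +-identityʳ x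
get-cell {suc h} (x ∷ st) (suc i) rewrite δ-> (cell-< i) | *-zeroʳ x = get-cell st i

get-inc : ∀ {h} (st : Vec ℕ h) i → get (st [ i ]%= suc) ≗ δ (cell i) ∔ get st
get-inc {suc h} (x ∷ st) zero    j = +-assoc (δ h j) (x * δ h j) (get st j)
get-inc {suc h} (x ∷ st) (suc i) j = begin
  x * δ h j + get (st [ i ]%= suc) j        ≡⟨ cong (x * δ h j +_) (get-inc st i j) ⟩
  x * δ h j + (δ (cell i) j + get st j)      ≡⟨ +-assoc (x * δ h j) _ _ ⟨
  x * δ h j + δ (cell i) j + get st j        ≡⟨ cong (_+ get st j) (+-comm (x * δ h j) _) ⟩
  δ (cell i) j + x * δ h j + get st j        ≡⟨ +-assoc (δ (cell i) j) _ _ ⟩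
  δ (cell i) j + (x * δ h j + get st j)      ∎
  where open ≡-Reasoning

-- Accepting every state pointwise equal to the stack lets executions be chained without an equality
-- of functions.
record Exec (p : Prog) {h h′} (st : Vec ℕ h) (st′ : Vec ℕ h′) : Set where
  constructor exec
  field executes : ∀ {s} → s ≗ get st → ∃[ t ] t ≗ get st′ × Run p s t
open Exec

private variable
  m n h h′ h″ : ℕ

skip : {st st′ : Vec ℕ h} → st ≡ st′ → Exec nil st st′
skip refl .executes {s} s≗ = s , s≗ , nil

castˡ : ∀ {p} {st₁ st₂ : Vec ℕ h} {st′ : Vec ℕ h′} → st₁ ≡ st₂ → Exec p st₁ st′ → Exec p st₂ st′
castˡ refl e = e

castʳ : ∀ {p} {st : Vec ℕ h} {st₁ st₂ : Vec ℕ h′} → st₁ ≡ st₂ → Exec p st st₁ → Exec p st st₂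
castʳ refl e = e

infixr 5 _⨟ˣ_
_⨟ˣ_ : ∀ {p q} {st : Vec ℕ h} {st′ : Vec ℕ h′} {st″ : Vec ℕ h″} →
       Exec p st st′ → Exec q st′ st″ → Exec (p ⨟ q) st st″
(e ⨟ˣ f) .executes s≗ with e .executes s≗
... | t , t≗ , r with f .executes t≗
... | u , u≗ , r′ = u , u≗ , ⨟-run r r′

push : ∀ {p} {st : Vec ℕ h} {st′ : Vec ℕ h′} → Exec p (0 ∷ st) st′ → Exec p st st′
push e .executes = e .executes

pop : ∀ {p} {st : Vec ℕ h} {st′ : Vec ℕ h′} → Exec p st (0 ∷ st′) → Exec p st st′
pop e .executes = e .executes

unpop : ∀ {p} {st : Vec ℕ h} {st′ : Vec ℕ h′} → Exec p st st′ → Exec p st (0 ∷ st′)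
unpop e .executes = e .executes

incr : Fin h → Prog
incr i = inc (cell i) nil

loop : Fin h → Prog → Prog
loop i p = while (cell i) p nil

incr-x : (i : Fin h) (st : Vec ℕ h) → Exec (incr i) st (st [ i ]%= suc)
incr-x i st .executes {s} s≗ =
  δ (cell i) ∔ s , (λ j → trans (cong (δ (cell i) j +_) (s≗ j)) (sym (get-inc st i j))) , inc nil

loop-exit : ∀ {p} (i : Fin h) (st : Vec ℕ h) → lookup st i ≡ 0 → Exec (loop i p) st st
loop-exit i st eq .executes {s} s≗ = s , s≗ , exit (trans (s≗ (cell i)) (trans (get-cell st i) eq)) nil

loop-iter : ∀ {p} (i : Fin h) (st : Vec ℕ h) {st′ : Vec ℕ h′} {st″ : Vec ℕ h″} →
            Exec p st st′ → Exec (loop i p) st′ st″ → Exec (loop i p) (st [ i ]%= suc) st″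
loop-iter i st e f .executes s≗ with (e ⨟ˣ f) .executes {get st} (λ _ → refl)
... | u , u≗ , r = u , u≗ , iter (λ j → trans (s≗ j) (get-inc st i j)) r

clear : Fin h → Prog
clear i = loop i nil

lookup-set : (i : Fin h) (st : Vec ℕ h) → ∀ {k} → lookup (st [ i ]≔ k) i ≡ k
lookup-set i st = lookup∘update i st _

set-suc : ∀ {k} (i : Fin h) (st : Vec ℕ h) → (st [ i ]≔ k) [ i ]%= suc ≡ st [ i ]≔ suc k
set-suc i st = updateAt-updateAt i st

clear-x : (i : Fin h) (st : Vec ℕ h) → ∀ v → Exec (clear i) (st [ i ]≔ v) (st [ i ]≔ 0)
clear-x i st zero    = loop-exit i _ (lookup-set i st)
clear-x i st (suc v) = castˡ (set-suc i st) (loop-iter i (st [ i ]≔ v) (skip refl) (clear-x i st v))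

move : Fin h → Prog
move {h} i = loop {suc h} zero (incr i)

move-x : (i : Fin h) (st : Vec ℕ h) → ∀ x y → Exec (move i) (x ∷ (st [ i ]≔ y)) (st [ i ]≔ (x + y))
move-x i st zero    y = pop (loop-exit zero (0 ∷ _) refl)
move-x i st (suc x) y =
  loop-iter zero (x ∷ (st [ i ]≔ y)) (incr-x (suc i) (x ∷ (st [ i ]≔ y)))
    (castˡ (cong (x ∷_) (sym (set-suc i st))) (castʳ (cong (st [ i ]≔_) (+-suc x y)) (move-x i st x (suc y))))

-- Reading a register destroys it. So `copy` drains the cell into two fresh ones, then moves one of
-- them back.
copy-out : Fin h → Prog
copy-out {h} i = loop i (incr {suc (suc h)} (suc zero) ⨟ incr {suc (suc h)} zero)

copy-out-x : (i : Fin h) (st : Vec ℕ h) → ∀ k t y →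
             Exec (copy-out i) (t ∷ y ∷ (st [ i ]≔ k)) (k + t ∷ k + y ∷ (st [ i ]≔ 0))
copy-out-x i st zero    t y = loop-exit (suc (suc i)) (t ∷ y ∷ _) (lookup-set i st)
copy-out-x i st (suc k) t y =
  castˡ (cong (λ u → t ∷ y ∷ u) (set-suc i st))
    (loop-iter (suc (suc i)) (t ∷ y ∷ (st [ i ]≔ k))
      (incr-x (suc zero) (t ∷ y ∷ _) ⨟ˣ incr-x zero (t ∷ suc y ∷ _))
      (castʳ (cong₂ (λ a b → a ∷ b ∷ (st [ i ]≔ 0)) (+-suc k t) (+-suc k y)) (copy-out-x i st k (suc t) (suc y))))

copy : Fin h → Prog
copy {h} i = copy-out i ⨟ move {suc h} (suc i)

copy-x : (i : Fin h) (st : Vec ℕ h) → Exec (copy i) st (lookup st i ∷ st)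
copy-x i st =
  push (push (castˡ (cong (λ u → 0 ∷ 0 ∷ u) ([]≔-lookup st i))
    (copy-out-x i st k 0 0 ⨟ˣ castʳ end (move-x (suc i) (k + 0 ∷ st) (k + 0) 0))))
  where
  k = lookup st i
  end : k + 0 ∷ (st [ i ]≔ (k + 0 + 0)) ≡ k ∷ st
  end = cong₂ _∷_ (+-identityʳ k)
          (trans (cong (st [ i ]≔_) (trans (+-identityʳ _) (+-identityʳ k))) ([]≔-lookup st i))

clear-top : (n : ℕ) → ℕ → Prog
clear-top n zero    = nil
clear-top n (suc m) = clear {suc (m + n)} zero ⨟ clear-top n m

clear-top-x : (ys : Vec ℕ m) (st : Vec ℕ h) → Exec (clear-top h m) (ys ++ᵛ st) st
clear-top-x []       st = skip refl
clear-top-x (y ∷ ys) st = pop (clear-x zero (y ∷ ys ++ᵛ st) y) ⨟ˣ clear-top-x ys st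

-- Calling convention: arguments are addressed by their position in the stack and survive the call,
-- the result is pushed, and all work cells are 0 again at the end.
code-PR  : PR n → Vec (Fin h) n → Prog
code-PRs : PRs m n → Vec (Fin h) n → Prog

code-PR zeroF        ins       = nil
code-PR {h = h} succF (i ∷ []) = copy i ⨟ incr {suc h} zero
code-PR (proj i)     ins       = copy (lookup ins i)
code-PR {h = h} (comp {m} f gs) ins =
  -- A silent 0 below the values of `gs` reserves the cell of the result; hence `map suc` and the
  -- height `suc h`.
  code-PRs gs (map suc ins) ⨟ code-PR f (tabulate λ j → j ↑ˡ suc h) ⨟ move (m ↑ʳ (zero {h})) ⨟ clear-top (suc h) m
code-PR {h = h} (prec f g) (k ∷ ins) =
  -- Above the old stack the loop keeps, from the top, the rounds left, the current index and the
  -- accumulator. The index starts as a silent 0.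
  code-PR f ins ⨟ copy {suc (suc h)} (suc (suc k)) ⨟
  loop {suc (suc (suc h))} zero
    (code-PR g (suc zero ∷ suc (suc zero) ∷ map (3 ↑ʳ_) ins) ⨟
     clear {suc (suc (suc (suc h)))} (suc (suc (suc zero))) ⨟ move {suc (suc (suc h))} (suc (suc zero)) ⨟
     incr {suc (suc (suc h))} (suc zero)) ⨟
  clear {suc (suc h)} zero
code-PR {h = h} (mu f) ins =
  -- The candidate lies below the value of `f` and starts as a silent 0.
  code-PR f (zero ∷ map suc ins) ⨟
  loop {suc (suc h)} zero (clear {suc (suc h)} zero ⨟ incr {suc h} zero ⨟ code-PR f (zero ∷ map suc ins))

code-PRs []                 ins = nil
code-PRs (_∷_ {m} g gs) ins = code-PRs gs ins ⨟ code-PR g (map (m ↑ʳ_) ins)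

map-lookup-++ʳ : (ys : Vec ℕ m) (st : Vec ℕ h) (ins : Vec (Fin h) n) →
                 map (lookup (ys ++ᵛ st)) (map (m ↑ʳ_) ins) ≡ map (lookup st) ins
map-lookup-++ʳ ys st ins = trans (sym (map-∘ _ _ ins)) (map-cong (lookup-++ʳ ys st) ins)

map-lookup-++ˡ : (ys : Vec ℕ m) (st : Vec ℕ h) →
                 map (lookup (ys ++ᵛ st)) (tabulate λ j → j ↑ˡ h) ≡ ys
map-lookup-++ˡ ys st =
  trans (sym (tabulate-∘ _ _)) (trans (tabulate-cong (lookup-++ˡ ys st)) (tabulate∘lookup ys))

code-PR-x  : (f : PR n) {st : Vec ℕ h} (ins : Vec (Fin h) n) → ∀ {xs y} →
             map (lookup st) ins ≡ xs → Eval f xs y → Exec (code-PR f ins) st (y ∷ st)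
code-PRs-x : (gs : PRs m n) {st : Vec ℕ h} (ins : Vec (Fin h) n) → ∀ {xs ys} →
             map (lookup st) ins ≡ xs → Evals gs xs ys → Exec (code-PRs gs ins) st (ys ++ᵛ st)

code-PR-x zeroF ins eq zeroE = unpop (skip refl)
code-PR-x succF (i ∷ []) refl succE = copy-x i _ ⨟ˣ incr-x zero _
code-PR-x (proj i) {st} ins refl projE = castʳ (cong (_∷ st) (sym (lookup-map i _ ins))) (copy-x (lookup ins i) st)
code-PR-x {h = h} (comp {m} f gs) {st} ins eq (compE {ys = ys} {y = y} evs ev) =
  push (code-PRs-x gs (map suc ins) (trans (map-lookup-++ʳ (0 ∷ []) st ins) eq) evs) ⨟ˣ
  code-PR-x f (tabulate λ j → j ↑ˡ suc h) (map-lookup-++ˡ ys (0 ∷ st)) ev ⨟ˣ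
  castˡ (cong (y ∷_) (set-++ ys 0)) (castʳ (trans (set-++ ys (y + 0)) (cong (λ v → ys ++ᵛ v ∷ st) (+-identityʳ y)))
    (move-x (m ↑ʳ zero) (ys ++ᵛ 0 ∷ st) y 0)) ⨟ˣ
  clear-top-x ys (y ∷ st)
  where
  set-++ : ∀ {m} (ys : Vec ℕ m) v → (ys ++ᵛ 0 ∷ st) [ m ↑ʳ zero ]≔ v ≡ ys ++ᵛ v ∷ st
  set-++ []       v = refl
  set-++ (x ∷ ys) v = cong (x ∷_) (set-++ ys v)
code-PR-x {h = h} (prec f g) {st} (k ∷ ins) refl ev =
  code-PR-x f ins refl ev₀ ⨟ˣ
  push (copy-x (suc (suc k)) (0 ∷ r₀ ∷ st)) ⨟ˣ
  pop (castˡ (cong (λ t → t ∷ 0 ∷ r₀ ∷ st) (+-identityʳ _)) (iterate (loop-exit zero (0 ∷ _) refl))) ⨟ˣ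
  pop (clear-x zero (lookup st k ∷ _ ∷ st) (lookup st k))
  where
  body = code-PR g (suc zero ∷ suc (suc zero) ∷ map (3 ↑ʳ_) ins) ⨟
         clear {suc (suc (suc (suc h)))} (suc (suc (suc zero))) ⨟ move {suc (suc (suc h))} (suc (suc zero)) ⨟
         incr {suc (suc (suc h))} (suc zero)
  -- The derivation descends from the last index while the loop ascends from 0. Therefore the rest
  -- of the loop is passed as a continuation, to which each recursion step prepends one iteration.
  unroll : ∀ {i r} → Eval (prec f g) (i ∷ map (lookup st) ins) r →
           ∃[ r₀ ] Eval f (map (lookup st) ins) r₀ ×
             (∀ {t} {z : Vec ℕ (3 + h)} → Exec (loop {3 + h} zero body) (t ∷ i ∷ r ∷ st) z →
                      Exec (loop {3 + h} zero body) (i + t ∷ 0 ∷ r₀ ∷ st) z)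
  unroll (prec0 {y = r} ev₀) = r , ev₀ , λ e → e
  unroll (precS {k = i} {r = r} {y = r′} ev ev′) with unroll ev
  ... | r₀ , ev₀ , rec = r₀ , ev₀ , λ {t} e →
    castˡ (cong (λ t → t ∷ 0 ∷ r₀ ∷ st) (+-suc i t)) (rec (loop-iter zero (t ∷ i ∷ r ∷ st)
      (code-PR-x g _ (cong (λ us → i ∷ r ∷ us) (map-lookup-++ʳ (t ∷ i ∷ r ∷ []) st ins)) ev′ ⨟ˣ
       clear-x (suc (suc (suc zero))) (r′ ∷ t ∷ i ∷ r ∷ st) r ⨟ˣ
       castʳ (cong (λ v → t ∷ i ∷ v ∷ st) (+-identityʳ r′)) (move-x (suc (suc zero)) (t ∷ i ∷ r ∷ st) r′ 0) ⨟ˣ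
       incr-x (suc zero) (t ∷ i ∷ r′ ∷ st)) e))
  r₀ = proj₁ (unroll ev)
  ev₀ = proj₁ (proj₂ (unroll ev))
  iterate = proj₂ (proj₂ (unroll ev))
code-PR-x {h = h} (mu f) {st} ins eq (muE {y = y} ev₀ evs) with search y 0 (+-identityʳ y)
  where
  body = clear {suc (suc h)} zero ⨟ incr {suc h} zero ⨟ code-PR f (zero ∷ map suc ins)
  eval : ∀ {z v} → Eval f (z ∷ _) v → Exec (code-PR f (zero ∷ map suc ins)) (z ∷ st) (v ∷ z ∷ st)
  eval {z} ev = code-PR-x f _ (cong (z ∷_) (trans (map-lookup-++ʳ (z ∷ []) st ins) eq)) ev
  -- `n` counts the candidates from `z` up to the least zero `y`.
  search : ∀ n z → n + z ≡ y →
           ∃[ v ] Exec (code-PR f (zero ∷ map suc ins)) (z ∷ st) (v ∷ z ∷ st) ×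
                  Exec (loop {suc (suc h)} zero body) (v ∷ z ∷ st) (y ∷ st)
  search zero    z refl = 0 , eval ev₀ , pop (loop-exit zero (0 ∷ z ∷ st) refl)
  search (suc n) z eq with search n (suc z) (trans (+-suc n z) eq) | evs z (subst (z <_) eq (s≤s (m≤n+m z n)))
  ... | v′ , e′ , l | v , ev = suc v , eval ev , loop-iter zero (v ∷ z ∷ st)
    (pop (clear-x zero (v ∷ z ∷ st) v) ⨟ˣ incr-x zero (z ∷ st) ⨟ˣ e′) l
... | v , e , l = push e ⨟ˣ l

code-PRs-x []       ins eq []         = skip refl
code-PRs-x (g ∷ gs) {st} ins eq (_∷_ {ys = ys} ev evs) =
  code-PRs-x gs ins eq evs ⨟ˣ code-PR-x g _ (trans (map-lookup-++ʳ ys st ins) eq) ev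

-- The vector addition system

-- Active runs pass through guess, run, swap and unswap, passive ones through hub and mult.  The phases
-- hub′ and mult′ serve to let every passive transition change the phase, hence not be a self-loop.
data Phase : Set where
  boot guess run swap unswap hub hub′ mult mult′ out : Phase

Ctl : Set
Ctl = Phase × Prog

-- The inputs are loaded into the registers.  The counters tests and fuel are consumed, bound, quota
-- and volume are b, c and v; spare is the buffer of the weak multiplication.
record Stock : Set where
  constructor stock
  field
    inputs : Fin 3 → ℕ
    tests fuel bound quota volume spare : ℕ
    regs coregs : ℕ → ℕ
open Stock

empty : Stock
empty = stock (λ _ → 0) 0 0 0 0 0 0 (λ _ → 0) (λ _ → 0)

-- Finite data naming at most one register and one coregister, so that `touch` can bound the
-- registers in use. Quota and volume are never consumed.
record Need : Set where
  constructor need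
  field
    input : Maybe (Fin 3)
    tests fuel bound spare : ℕ
    reg coreg : Maybe ℕ
module N = Need

nought : Need
nought = need nothing 0 0 0 0 nothing nothing

δ? : Maybe ℕ → State
δ? nothing  j = 0
δ? (just r) j = δ r j

δ³ : Fin 3 → Fin 3 → ℕ
δ³ k l = δ (toℕ k) (toℕ l)

δ³? : Maybe (Fin 3) → Fin 3 → ℕ
δ³? nothing  l = 0
δ³? (just k) l = δ³ k l

⌊_⌋ : Need → Stock
⌊ need i c f b s r r̄ ⌋ = stock (δ³? i) c f b 0 0 s (δ? r) (δ? r̄)

record Fits (n : Need) (d : Stock) : Set where
  constructor fits
  field
    inputs : ∀ k → δ³? (N.input n) k ≤ inputs d k
    tests  : N.tests n ≤ tests d
    fuel   : N.fuel n  ≤ fuel d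
    bound  : N.bound n ≤ bound d
    spare  : N.spare n ≤ spare d
    regs   : ∀ j → δ? (N.reg n) j   ≤ regs d j
    coregs : ∀ j → δ? (N.coreg n) j ≤ coregs d j
module F = Fits

-- With the gain on the left, gaining 1 reduces to `suc` and gaining nothing disappears, so most
-- fields of `apply n d` compute.
exchange : Stock → Stock → Stock → Stock
exchange d m p = stock
  (λ k → inputs p k + (inputs d k ∸ inputs m k))
  (tests p  + (tests d  ∸ tests m))
  (fuel p   + (fuel d   ∸ fuel m))
  (bound p  + (bound d  ∸ bound m))
  (quota p  + (quota d  ∸ quota m))
  (volume p + (volume d ∸ volume m))
  (spare p  + (spare d  ∸ spare m))
  (λ j → regs p j   + (regs d j   ∸ regs m j))
  (λ j → coregs p j + (coregs d j ∸ coregs m j))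

data Name : Set where
  goActive raise allot refuel launch accept : Name
  load : Fin 3 → Name
  inc : ℕ → Prog → Name
  iter enter swap turn unswap leave : ℕ → Prog → Prog → Name
  goPassive rest back addBound restore round mul mulBack endRound halt : Name
  drop : Fin 3 → Name
  addReg addCoreg : ℕ → Name

module _ (p₀ : Prog) where

  src dst : Name → Ctl

  src goActive       = boot , nil
  src raise          = guess , nil
  src allot          = guess , nil
  src refuel         = guess , nil
  src launch         = guess , nil
  src accept         = run , nil
  src (load k)       = guess , nil
  src (inc r p)      = run , inc r p
  src (iter r p q)   = run , while r p q
  src (enter r p q)  = run , while r p q
  src (swap r p q)   = swap , while r p q
  src (turn r p q)   = swap , while r p q
  src (unswap r p q) = unswap , while r p q
  src (leave r p q)  = unswap , while r p q
  src goPassive      = boot , nil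
  src rest           = hub , nil
  src back           = hub′ , nil
  src addBound       = hub , nil
  src restore        = hub , nil
  src round          = hub , nil
  src mul            = mult , nil
  src mulBack        = mult′ , nil
  src endRound       = mult , nil
  src halt           = hub , nil
  src (drop k)       = hub , nil
  src (addReg j)     = hub , nil
  src (addCoreg j)   = hub , nil

  dst goActive       = guess , nil
  dst raise          = guess , nil
  dst allot          = guess , nil
  dst refuel         = guess , nil
  dst launch         = run , p₀
  dst accept         = out , nil
  dst (load k)       = guess , nil
  dst (inc r p)      = run , p
  dst (iter r p q)   = run , p ⨟ while r p q
  dst (enter r p q)  = swap , while r p q
  dst (swap r p q)   = swap , while r p q
  dst (turn r p q)   = unswap , while r p q
  dst (unswap r p q) = unswap , while r p q
  dst (leave r p q)  = run , q
  dst goPassive      = hub , nil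
  dst rest           = hub′ , nil
  dst back           = hub , nil
  dst addBound       = hub′ , nil
  dst restore        = hub′ , nil
  dst round          = mult , nil
  dst mul            = mult′ , nil
  dst mulBack        = mult , nil
  dst endRound       = hub , nil
  dst halt           = out , nil
  dst (drop k)       = hub′ , nil
  dst (addReg j)     = hub′ , nil
  dst (addCoreg j)   = hub′ , nil

pre : Name → Need
pre accept         = record nought { reg = just 3 }
pre (load k)       = record nought { input = just k ; coreg = just (toℕ k) }
pre (inc r p)      = record nought { coreg = just r }
pre (iter r p q)   = record nought { reg = just r }
pre (enter r p q)  = record nought { tests = 1 }
pre (swap r p q)   = record nought { fuel = 1 ; coreg = just r }
pre (unswap r p q) = record nought { fuel = 1 ; reg = just r }
pre restore        = record nought { spare = 1 }
pre mul            = record nought { bound = 1 }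
pre (drop k)       = record nought { input = just k }
pre _              = nought

post : Name → Stock
-- All coregisters grow along with the bound, which preserves `Balanced`.
post raise          = record empty { bound = 1 ; coregs = λ _ → 1 }
post allot          = record empty { tests = 1 ; quota = 1 }
post refuel         = record empty { fuel = 2 ; volume = 1 }
post accept         = record empty { volume = 1 }
post (load k)       = record empty { regs = δ (toℕ k) }
post (inc r p)      = record empty { regs = δ r }
post (iter r p q)   = record empty { coregs = δ r }
post (swap r p q)   = record empty { regs = δ r }
post (unswap r p q) = record empty { coregs = δ r }
post addBound       = record empty { bound = 1 }
post restore        = record empty { bound = 1 }
post round          = record empty { quota = 1 }
post mul            = record empty { spare = 1 ; volume = 1 }
post (addReg j)     = record empty { regs = δ j }
post (addCoreg j)   = record empty { coregs = δ j }
post _              = empty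

apply : Name → Stock → Stock
apply n d = exchange d ⌊ pre n ⌋ (post n)

-- The control state is the program still to be run. Every such program is a subprogram followed by
-- a fixed continuation `k`, so finitely many nonempty ones occur.
nodes : Prog → Prog → List Prog
nodes nil           k = []
nodes (inc r p)     k = inc r (p ⨟ k) ∷ nodes p k
nodes (while r p q) k = while r p (q ⨟ k) ∷ nodes p (while r p (q ⨟ k)) ++ nodes q k

nodeNames : Prog → List Name
nodeNames nil           = []
nodeNames (inc r p)     = inc r p ∷ []
nodeNames (while r p q) =
  iter r p q ∷ enter r p q ∷ swap r p q ∷ turn r p q ∷ unswap r p q ∷ leave r p q ∷ []

fixedNames : List Name
fixedNames =
  goActive ∷ raise ∷ allot ∷ refuel ∷ launch ∷ accept ∷ load zero ∷ load (suc zero) ∷ load (suc (suc zero)) ∷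
  goPassive ∷ rest ∷ back ∷ addBound ∷ restore ∷ round ∷ mul ∷ mulBack ∷ endRound ∷ halt ∷
  drop zero ∷ drop (suc zero) ∷ drop (suc (suc zero)) ∷ []

-- Invariants of the reachable configurations

module VASS (p₀ : Prog) (i : Fin 3 → ℕ) (names : List Name) where

  start : Stock
  start = record empty { inputs = i }

  s₀ : State
  s₀ = get (i (suc (suc zero)) ∷ i (suc zero) ∷ i zero ∷ [])

  s₀-toℕ : ∀ k → s₀ (toℕ k) ≡ i k
  s₀-toℕ zero             = get-cell (i (suc (suc zero)) ∷ i (suc zero) ∷ i zero ∷ []) (suc (suc zero))
  s₀-toℕ (suc zero)       = get-cell (i (suc (suc zero)) ∷ i (suc zero) ∷ i zero ∷ []) (suc zero)
  s₀-toℕ (suc (suc zero)) = get-cell (i (suc (suc zero)) ∷ i (suc zero) ∷ i zero ∷ []) zero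

  data Reached : Ctl → Stock → Set where
    boots : Reached (boot , nil) start
    fires : ∀ n {d} → Reached (src p₀ n) d → n ∈ names → Fits (pre n) d → Reached (dst p₀ n) (apply n d)

  -- `Fair` mentions only quantities that no transition changes between `launch` and `accept`. Hence
  -- fairness checked at the end of the simulation holds throughout it.
  Balanced Fair : Stock → Set
  Balanced d = ∀ j → regs d j + coregs d j ≡ bound d
  Fair d     = (∀ k → inputs d k ≡ 0) × quota d * bound d ≤ volume d

  -- Phrased by continuations: each transition extends the run to come at its front, and at `nil` a
  -- run of `p₀` ending in these registers results.
  Honest : Prog → State → Set
  Honest p x = ∃[ s ] s ≗ x × (∀ t → Run p s t → Run p₀ s₀ t)

  -- During a test register `r` holds tokens borrowed from its coregister; `s` is the simulated
  -- state, in which `r` is empty.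
  HonestTest : ℕ → Prog → State → Set
  HonestTest r q x = ∃[ s ] s r ≡ 0 × (∀ j → δ r j ≡ 0 → s j ≡ x j) × (∀ t → Run q s t → Run p₀ s₀ t)

  Tight : ℕ → ℕ → Set → Set
  Tight cost fuel H = cost ≤ fuel × (fuel ≡ cost → H)

  -- At least the fuel for honest tests is left; an excess can never be used up, and without an excess
  -- the simulation has been honest so far.
  InvA : Stock → ℕ → Set → Set
  InvA d extra H = Balanced d × spare d ≡ 0 × (Fair d → Tight (tests d * (bound d + bound d) + extra) (fuel d) H)

  Inv : Ctl → Stock → Set
  Inv (boot , _)             d = d ≡ start
  Inv (guess , _)            d = Balanced d × spare d ≡ 0 × tests d ≡ quota d × fuel d ≡ volume d + volume d ×
                                 (∀ k → inputs d k + regs d (toℕ k) ≡ i k) × (∀ j → 3 ≤ j → regs d j ≡ 0)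
  Inv (run , p)              d = InvA d 0 (Honest p (regs d))
  -- Still to be paid for this test: what is left in the coregister, then `bound d` moves back.
  Inv (swap , while r p q)   d = InvA d (bound d + coregs d r) (HonestTest r q (regs d))
  Inv (unswap , while r p q) d = InvA d (regs d r) (HonestTest r q (regs d))
  Inv (hub , _)              d = volume d ≤ quota d * (bound d + spare d)
  Inv (hub′ , _)             d = volume d ≤ quota d * (bound d + spare d)
  -- Each token left in `bound` may still become a unit of volume in the current round.
  Inv (mult , _)             d = volume d + bound d ≤ quota d * (bound d + spare d)
  Inv (mult′ , _)            d = volume d + bound d ≤ quota d * (bound d + spare d)
  Inv _                      d = ⊤

  shiftˡ : ∀ {a x y} → a ≤ y → (a + x) + (y ∸ a) ≡ x + y
  shiftˡ {a} {x} {y} a≤y = begin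
    (a + x) + (y ∸ a)  ≡⟨ cong (_+ (y ∸ a)) (+-comm a x) ⟩
    (x + a) + (y ∸ a)  ≡⟨ +-assoc x a _ ⟩
    x + (a + (y ∸ a))  ≡⟨ cong (x +_) (m+[n∸m]≡n a≤y) ⟩
    x + y              ∎
    where open ≡-Reasoning

  shiftʳ : ∀ {a x y} → a ≤ x → (x ∸ a) + (a + y) ≡ x + y
  shiftʳ {a} {x} {y} a≤x = trans (+-comm (x ∸ a) (a + y)) (trans (shiftˡ a≤x) (+-comm y x))

  -- Lowering the cost by `e` wastes `e` units of fuel for good. If the fuel nevertheless equals the
  -- new cost, then `e` is 0, and this is the evidence of honesty given to `f`.
  slack : ∀ {old new e F H H′} → old ≡ new + e → (e ≡ 0 → H → H′) → Tight old F H → Tight new F H′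
  slack {old} {new} {e} {F} refl f (old≤F , h) =
    ≤-trans (m≤m+n new e) old≤F ,
    λ F≡new → let e≡0 = n≤0⇒n≡0 (+-cancelˡ-≤ new e 0 (≤-trans old≤F (≤-reflexive (trans F≡new (sym (+-identityʳ new)))))) in
      f e≡0 (h (trans F≡new (sym (trans (cong (new +_) e≡0) (+-identityʳ new)))))

  -- A move lowers fuel and cost alike, so it wastes nothing.
  burn : ∀ {old new F H H′} → 1 ≤ F → old ≡ suc new → (H → H′) → Tight old F H → Tight new (F ∸ 1) H′
  burn (s≤s _) refl f (s≤s old≤F , h) = old≤F , λ F≡ → f (h (cong suc F≡))

  open +-*-Solver using (solve; _:+_; _:=_; con)

  -- The waste is the content `x` of the tested register: nothing is lost just if it is 0.
  enter-cost : ∀ {x y b} c → 1 ≤ c → x + y ≡ b →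
               c * (b + b) + 0 ≡ (c ∸ 1) * (b + b) + (b + y) + x
  enter-cost {x} {y} (suc c) _ refl =
    solve 3 (λ m x y → (x :+ y :+ (x :+ y)) :+ m :+ con 0 := m :+ (x :+ y :+ y) :+ x) refl (c * (x + y + (x + y))) x y

  -- Turning early forfeits `y` moves forth and as many back.
  turn-cost : ∀ {x y b} m → x + y ≡ b → m + (b + y) ≡ m + x + (y + y)
  turn-cost {x} {y} m refl = solve 3 (λ m x y → m :+ (x :+ y :+ y) := m :+ x :+ (y :+ y)) refl m x y

  at-r : ∀ {r} (f : State) → 1 ≤ f r → f r ≡ suc (f r ∸ δ r r)
  at-r {r} f 1≤ rewrite δ-refl r = sym (m+[n∸m]≡n 1≤)

  1≤at : ∀ {r} {f : State} → (∀ j → δ r j ≤ f j) → 1 ≤ f r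
  1≤at {r} {f} le = subst (_≤ f r) (δ-refl r) (le r)

  keepˡ : ∀ {r q x} → HonestTest r q x → HonestTest r q (δ r ∔ x)
  keepˡ (s , s≡0 , s≡ , h) = s , s≡0 , (λ j δ≡0 → trans (s≡ j δ≡0) (cong (_+ _) (sym δ≡0))) , h

  keepʳ : ∀ {r q x} → HonestTest r q x → HonestTest r q (λ j → x j ∸ δ r j)
  keepʳ {x = x} (s , s≡0 , s≡ , h) = s , s≡0 , (λ j δ≡0 → trans (s≡ j δ≡0) (cong (x j ∸_) (sym δ≡0))) , h

  s₀-loaded : (I : Fin 3 → ℕ) → ∀ {X} → (∀ k → I k + X (toℕ k) ≡ i k) → (∀ j → 3 ≤ j → X j ≡ 0) → (∀ k → I k ≡ 0) → s₀ ≗ X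
  s₀-loaded I {X} in≡ hi≡ in≡0 j with j <? 3
  ... | yes j<3 = subst (λ j → s₀ j ≡ X j) (toℕ-fromℕ< j<3)
                    (trans (s₀-toℕ k) (trans (sym (in≡ k)) (cong (_+ X (toℕ k)) (in≡0 k))))
    where k = fromℕ< j<3
  ... | no  j≮3 = trans (get-high (i (suc (suc zero)) ∷ i (suc zero) ∷ i zero ∷ []) (≮⇒≥ j≮3)) (sym (hi≡ j (≮⇒≥ j≮3)))

  inv : ∀ {c d} → Reached c d → Inv c d
  inv boots = refl
  inv (fires goActive v _ fit) rewrite inv v =
    (λ _ → refl) , refl , refl , refl , (λ k → +-identityʳ (i k)) , λ _ _ → refl
  inv (fires raise {d} v _ fit) with inv v
  ... | bal , sp , t≡ , f≡ , in≡ , hi≡ =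
    (λ j → trans (+-suc (regs d j) (coregs d j)) (cong suc (bal j))) , sp , t≡ , f≡ , in≡ , hi≡
  inv (fires allot v _ fit) with inv v
  ... | bal , sp , t≡ , f≡ , in≡ , hi≡ = bal , sp , cong suc t≡ , f≡ , in≡ , hi≡
  inv (fires refuel {d} v _ fit) with inv v
  ... | bal , sp , t≡ , f≡ , in≡ , hi≡ =
    bal , sp , t≡ , cong suc (trans (cong suc f≡) (sym (+-suc (volume d) (volume d)))) , in≡ , hi≡
  inv (fires (load k) {d} v _ fit) with inv v
  ... | bal , sp , t≡ , f≡ , in≡ , hi≡ =
    (λ j → trans (shiftˡ (F.coregs fit j)) (bal j)) , sp , t≡ , f≡ ,
    (λ l → trans (shiftʳ (F.inputs fit l)) (in≡ l)) ,
    λ j 3≤j → cong₂ _+_ (δ-< (<-≤-trans (toℕ<n k) 3≤j)) (hi≡ j 3≤j)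
  inv (fires launch {d} v _ fit) with inv v
  ... | bal , sp , t≡ , f≡ , in≡ , hi≡ = bal , sp , λ (in≡0 , vol) → cost vol , λ _ → s₀ , s₀-loaded (inputs d) in≡ hi≡ in≡0 , λ _ ρ → ρ
    where
    -- The fuel is twice the volume and a test costs twice the bound, so fairness covers one honest
    -- test per unit of quota.
    cost : quota d * bound d ≤ volume d → tests d * (bound d + bound d) + 0 ≤ fuel d
    cost vol rewrite t≡ | f≡ | +-identityʳ (quota d * (bound d + bound d)) | *-distribˡ-+ (quota d) (bound d) (bound d) =
      +-mono-≤ vol vol
  inv (fires accept v _ fit) = tt
  inv (fires (inc r p) v _ fit) with inv v
  ... | bal , sp , h = (λ j → trans (shiftˡ (F.coregs fit j)) (bal j)) , sp , λ fair →
    proj₁ (h fair) , λ f≡ → let s , s≗ , hon = proj₂ (h fair) f≡ in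
      δ r ∔ s , (λ j → cong (δ r j +_) (s≗ j)) , λ t ρ → hon t (inc ρ)
  inv (fires (iter r p q) {d} v _ fit) with inv v
  ... | bal , sp , h = (λ j → trans (shiftʳ (F.regs fit j)) (bal j)) , sp , λ fair →
    proj₁ (h fair) , λ f≡ → let s , s≗ , hon = proj₂ (h fair) f≡ in
      (λ j → regs d j ∸ δ r j) , (λ _ → refl) ,
      λ t ρ → hon t (iter (λ j → trans (s≗ j) (sym (m+[n∸m]≡n (F.regs fit j)))) ρ)
  inv (fires (enter r p q) {d} v _ fit) with inv v
  ... | bal , sp , h = bal , sp , λ fair →
    slack (enter-cost (tests d) (F.tests fit) (bal r))
      (λ x≡0 (s , s≗ , hon) → s , trans (s≗ r) x≡0 , (λ j _ → s≗ j) , λ t ρ → hon t (exit (trans (s≗ r) x≡0) ρ)) (h fair)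
  inv (fires (swap r p q) {d} v _ fit) with inv v
  ... | bal , sp , h = (λ j → trans (shiftˡ (F.coregs fit j)) (bal j)) , sp , λ fair →
    burn (F.fuel fit) (trans (cong (λ y → due + (bound d + y)) (at-r (coregs d) (1≤at (F.coregs fit))))
                             (trans (cong (due +_) (+-suc (bound d) _)) (+-suc due _))) keepˡ (h fair)
    where due = tests d * (bound d + bound d)
  inv (fires (turn r p q) {d} v _ fit) with inv v
  ... | bal , sp , h = bal , sp , λ fair →
    slack (turn-cost (tests d * (bound d + bound d)) (bal r)) (λ _ → id) (h fair)
  inv (fires (unswap r p q) {d} v _ fit) with inv v
  ... | bal , sp , h = (λ j → trans (shiftʳ (F.regs fit j)) (bal j)) , sp , λ fair →
    burn (F.fuel fit) (trans (cong (due +_) (at-r (regs d) (1≤at (F.regs fit)))) (+-suc due _)) keepʳ (h fair)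
    where due = tests d * (bound d + bound d)
  inv (fires (leave r p q) {d} v _ fit) with inv v
  ... | bal , sp , h = bal , sp , λ fair →
    slack (cong (_+ regs d r) (sym (+-identityʳ (tests d * (bound d + bound d)))))
      (λ x≡0 (s , s≡0 , s≡ , hon) → s , agree x≡0 s≡0 s≡ , hon) (h fair)
    where
    agree : ∀ {s} → regs d r ≡ 0 → s r ≡ 0 → (∀ j → δ r j ≡ 0 → s j ≡ regs d j) → s ≗ regs d
    agree x≡0 s≡0 s≡ j with δ-dichotomy r j
    ... | inj₁ δ≡0  = s≡ j δ≡0
    ... | inj₂ refl = trans s≡0 (sym x≡0)
  inv (fires goPassive v _ fit) rewrite inv v = z≤n
  inv (fires rest v _ fit) = inv v
  inv (fires back v _ fit) = inv v
  inv (fires addBound {d} v _ fit) = ≤-trans (inv v) (*-monoʳ-≤ (quota d) (n≤1+n _))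
  inv (fires restore {stock _ _ _ b c _ (suc s) _ _} v _ fit) = ≤-trans (inv v) (≤-reflexive (cong (c *_) (+-suc b s)))
  inv (fires restore {stock _ _ _ b c _ zero _ _} v _ (fits _ _ _ _ () _ _))
  inv (fires round {d} v _ fit) =
    ≤-trans (≤-reflexive (+-comm (volume d) (bound d))) (+-mono-≤ (m≤m+n (bound d) (spare d)) (inv v))
  inv (fires mul {stock _ _ _ (suc b) c v s _ _} r _ fit) =
    ≤-trans (≤-reflexive (sym (+-suc v b))) (≤-trans (inv r) (≤-reflexive (cong (c *_) (sym (+-suc b s)))))
  inv (fires mul {stock _ _ _ zero _ _ _ _ _} r _ (fits _ _ _ () _ _ _))
  inv (fires mulBack v _ fit) = inv v
  inv (fires endRound {d} v _ fit) = ≤-trans (m≤m+n (volume d) (bound d)) (inv v)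
  inv (fires halt v _ fit) = tt
  inv (fires (drop k) v _ fit) = inv v
  inv (fires (addReg j) v _ fit) = inv v
  inv (fires (addCoreg j) v _ fit) = inv v

-- Construction of active and passive runs

touch : Name → ℕ
touch n = fromMaybe 0 (N.reg (pre n)) + fromMaybe 0 (N.coreg (pre n))

δ³-δ : ∀ {k} {I : Fin 3 → ℕ} → 1 ≤ I k → ∀ l → δ³ k l ≤ I l
δ³-δ {zero} 1≤ zero = 1≤
δ³-δ {zero} 1≤ (suc l) = z≤n
δ³-δ {suc k} 1≤ zero = z≤n
δ³-δ {suc zero} 1≤ (suc zero) = 1≤
δ³-δ {suc zero} 1≤ (suc (suc l)) = z≤n
δ³-δ {suc (suc k)} 1≤ (suc zero) = z≤n
δ³-δ {suc (suc zero)} 1≤ (suc (suc zero)) = 1≤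

-- An interface to the list of transitions, so that the proofs never unfold the concrete one. Only
-- registers below `width` will become places, and by `touch<` these include all that a precondition
-- mentions.
record Roster (p₀ : Prog) : Set where
  field
    names      : List Name
    width      : ℕ
    fixed∈     : ∀ {n} → n ∈ fixedNames → n ∈ names
    node∈      : ∀ {p n} → p ∈ nodes p₀ nil → n ∈ nodeNames p → n ∈ names
    addReg∈    : ∀ {j} → j < width → addReg j ∈ names
    addCoreg∈  : ∀ {j} → j < width → addCoreg j ∈ names
    touch<     : ∀ {n} → n ∈ names → touch n < width

module Simulation (p₀ : Prog) (i : Fin 3 → ℕ) (roster : Roster p₀) where

  open Roster roster
  open VASS p₀ i names

  -- The numerals in later uses are positions in `fixedNames`.
  fixed : (k : Fin (length fixedNames)) → lookupᴸ fixedNames k ∈ names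
  fixed k = fixed∈ (∈-lookup {xs = fixedNames} k)

  load∈ : ∀ k → load k ∈ names
  load∈ zero             = fixed (# 6)
  load∈ (suc zero)       = fixed (# 7)
  load∈ (suc (suc zero)) = fixed (# 8)

  drop∈ : ∀ k → drop k ∈ names
  drop∈ zero             = fixed (# 19)
  drop∈ (suc zero)       = fixed (# 20)
  drop∈ (suc (suc zero)) = fixed (# 21)

  -- q is a control point of p₀, given as a stack of suffixes of its subprograms.
  data Control (q : Prog) : Set where
    nil : q ≡ nil → Control q
    seg : ∀ p {k} → q ≡ p ⨟ k → (∀ {q′} → q′ ∈ nodes p k → q′ ∈ nodes p₀ nil) → Control k → Control q

  control₀ : Control p₀
  control₀ = seg p₀ (sym (⨟-identityʳ p₀)) id (nil refl)

  control-inc : ∀ {r p} → Control (inc r p) → inc r p ∈ nodes p₀ nil × Control p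
  control-inc (seg nil       refl sub ck) = control-inc ck
  control-inc (seg (inc r p) refl sub ck) = sub (here refl) , seg p refl (sub ∘ there) ck

  control-while : ∀ {r p q} → Control (while r p q) →
                  while r p q ∈ nodes p₀ nil × Control q × Control (p ⨟ while r p q)
  control-while (seg nil refl sub ck) = control-while ck
  control-while (seg (while r p q) refl sub ck) =
    sub (here refl) , seg q refl (sub ∘ there ∘ ∈-++⁺ʳ (nodes p _)) ck ,
    seg p refl (sub ∘ there ∘ ∈-++⁺ˡ) (seg (while r p q) refl sub ck)

  none : ∀ {d} → Fits nought d
  none = fits (λ _ → z≤n) z≤n z≤n z≤n z≤n (λ _ → z≤n) (λ _ → z≤n)

  module _ {r p q} (w∈ : while r p q ∈ nodes p₀ nil) where

    swaps : ∀ k {I n f b c v X Y} → Y r ≡ k →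
            Reached (swap , while r p q) (stock I n (k + f) b c v 0 X Y) →
            ∃₂ λ X′ Y′ → Y′ r ≡ 0 × (∀ j → δ r j ≡ 0 → X′ j ≡ X j) ×
              Reached (swap , while r p q) (stock I n f b c v 0 X′ Y′)
    swaps zero    Y≡ v = _ , _ , Y≡ , (λ _ _ → refl) , v
    swaps (suc k) {Y = Y} Y≡ v
      with swaps k (trans (cong₂ _∸_ Y≡ (δ-refl r)) refl)
        (fires (swap r p q) v (node∈ w∈ (there (there (here refl))))
          (fits (λ _ → z≤n) z≤n (s≤s z≤n) z≤n z≤n (λ _ → z≤n) (δ-≤ Y (subst (1 ≤_) (sym Y≡) (s≤s z≤n)))))
    ... | X′ , Y′ , Y′≡ , X′≡ , v′ = X′ , Y′ , Y′≡ , (λ j δ≡ → trans (X′≡ j δ≡) (cong (_+ _) δ≡)) , v′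

    unswaps : ∀ k {I n f b c v X Y} → X r ≡ k →
            Reached (unswap , while r p q) (stock I n (k + f) b c v 0 X Y) →
            ∃₂ λ X′ Y′ → X′ r ≡ 0 × (∀ j → δ r j ≡ 0 → X′ j ≡ X j) ×
              Reached (unswap , while r p q) (stock I n f b c v 0 X′ Y′)
    unswaps zero    X≡ v = _ , _ , X≡ , (λ _ _ → refl) , v
    unswaps (suc k) {X = X} X≡ v
      with unswaps k (trans (cong₂ _∸_ X≡ (δ-refl r)) refl)
        (fires (unswap r p q) v (node∈ w∈ (there (there (there (there (here refl))))))
          (fits (λ _ → z≤n) z≤n (s≤s z≤n) z≤n z≤n (δ-≤ X (subst (1 ≤_) (sym X≡) (s≤s z≤n))) (λ _ → z≤n)))
    ... | X′ , Y′ , X′0 , X′≡ , v′ = X′ , Y′ , X′0 , (λ j δ≡ → trans (X′≡ j δ≡) (cong (X j ∸_) δ≡)) , v′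

    zero-test : ∀ {I n b c v X Y} → X r ≡ 0 →
                Reached (run , while r p q) (stock I (suc n) (suc n * (b + b)) b c v 0 X Y) →
                ∃₂ λ X′ Y′ → X′ ≗ X × Reached (run , q) (stock I n (n * (b + b)) b c v 0 X′ Y′)
    zero-test {I} {n} {b} {c} {v} {X} {Y} X≡0 reached
      -- As `X r` is 0, the invariant `Balanced` puts exactly `b` tokens into the coregister; after
      -- the swaps it puts `b` into the register.
      with swaps b (trans (cong (_+ Y r) (sym X≡0)) (proj₁ (inv reached) r))
             (subst (λ f → Reached (swap , while r p q) (stock I n f b c v 0 X Y)) (+-assoc b b (n * (b + b)))
               (fires (enter r p q) reached (node∈ w∈ (there (here refl)))
                 (fits (λ _ → z≤n) (s≤s z≤n) z≤n z≤n z≤n (λ _ → z≤n) (λ _ → z≤n))))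
    ... | X₁ , Y₁ , Y₁≡0 , X₁≡ , reached₁
      with unswaps b (trans (trans (sym (+-identityʳ (X₁ r))) (cong (X₁ r +_) (sym Y₁≡0))) (proj₁ (inv reached₁) r))
             (fires (turn r p q) reached₁ (node∈ w∈ (there (there (there (here refl))))) none)
    ... | X₂ , Y₂ , X₂≡0 , X₂≡ , reached₂ =
      X₂ , Y₂ , agree ,
      fires (leave r p q) reached₂ (node∈ w∈ (there (there (there (there (there (here refl))))))) none
      where
      agree : X₂ ≗ X
      agree j with δ-dichotomy r j
      ... | inj₁ δ≡0  = trans (X₂≡ j δ≡0) (X₁≡ j δ≡0)
      ... | inj₂ refl = trans X₂≡0 (sym X≡0)

  -- `n` counts the zero tests of the run and `B` bounds its registers. Both are known before any
  -- guess is made, and every `b` from `B` on works with fuel for exactly `n` tests.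
  simulate : ∀ {p s t} → Run p s t → Control p →
    ∃₂ λ n B → ∀ {I b c v X Y} → B ≤ b → s ≗ X →
      Reached (run , p) (stock I n (n * (b + b)) b c v 0 X Y) →
      ∃₂ λ X′ Y′ → t ≗ X′ × Reached (run , nil) (stock I 0 0 b c v 0 X′ Y′)
  simulate nil _ = 0 , 0 , λ _ s≗ v → _ , _ , s≗ , v
  simulate {s = s} (inc {r} {p} ρ) ctl with control-inc ctl
  ... | p∈ , ctl′ with simulate ρ ctl′
  -- The bound must exceed `s r` strictly, so that the coregister has a token to give.
  ... | n , B , sim = n , B ⊔ suc (s r) , λ {_} {b} {_} {_} {X} {Y} B≤ s≗ v →
    sim (m⊔n≤o⇒m≤o B _ B≤) (λ j → cong (δ r j +_) (s≗ j))
      (fires (inc r p) v (node∈ p∈ (here refl))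
        (fits (λ _ → z≤n) z≤n z≤n z≤n z≤n (λ _ → z≤n)
          (δ-≤ Y (room (proj₁ (inv v) r) (≤-trans (s≤s (≤-reflexive (sym (s≗ r)))) (m⊔n≤o⇒n≤o B _ B≤))))))
    where
    room : ∀ {x y b} → x + y ≡ b → x < b → 1 ≤ y
    room {x} {y} refl x<x+y = +-cancelˡ-< x 0 y (subst (_< x + y) (sym (+-identityʳ x)) x<x+y)
  simulate (exit {r} {p} {q} s≡0 ρ) ctl with control-while ctl
  ... | w∈ , ctlq , _ with simulate ρ ctlq
  ... | n , B , sim = suc n , B , λ B≤ s≗ v →
    let X′ , Y′ , X′≗ , v′ = zero-test w∈ (trans (sym (s≗ r)) s≡0) v in
    sim B≤ (λ j → trans (s≗ j) (sym (X′≗ j))) v′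
  simulate (iter {r} {p} {q} s≗ ρ) ctl with control-while ctl
  ... | w∈ , _ , ctlp with simulate ρ ctlp
  ... | n , B , sim = n , B , λ {_} {_} {_} {_} {X} B≤ s≗X v →
    let X≗ = λ j → trans (sym (s≗X j)) (s≗ j) in
    sim B≤ (λ j → sym (trans (cong (_∸ δ r j) (X≗ j)) (m+n∸m≡n (δ r j) _)))
      (fires (iter r p q) v (node∈ w∈ (here refl))
        (fits (λ _ → z≤n) z≤n z≤n z≤n z≤n
          (λ j → subst (δ r j ≤_) (sym (X≗ j)) (m≤m+n (δ r j) _)) (λ _ → z≤n)))

  module _ (P : (Fin 3 → ℕ) → Set) (take : ∀ I k → P I → 1 ≤ I k → P (λ l → I l ∸ δ³ k l)) where

    drain₁ : ∀ k m I → I k ≡ m → P I → ∃[ I′ ] P I′ × I′ k ≡ 0 × (∀ l → I l ≡ 0 → I′ l ≡ 0)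
    drain₁ k zero    I I≡ x = I , x , I≡ , λ _ → id
    drain₁ k (suc m) I I≡ x
      with drain₁ k m (λ l → I l ∸ δ³ k l) (cong₂ _∸_ I≡ (δ-refl (toℕ k)))
             (take I k x (subst (1 ≤_) (sym I≡) (s≤s z≤n)))
    ... | I′ , x′ , I′≡ , keep = I′ , x′ , I′≡ , λ l I≡0 → keep l (trans (cong (_∸ δ³ k l) I≡0) (0∸n≡0 (δ³ k l)))

    -- Generic in `P` because inputs are emptied by `load` in active runs and by `drop` in passive
    -- ones.
    drain : ∀ {I} → P I → ∃[ I′ ] P I′ × (∀ k → I′ k ≡ 0)
    drain {I} x₀ with drain₁ zero _ I refl x₀
    ... | I₁ , x₁ , e₁ , _ with drain₁ (suc zero) _ I₁ refl x₁
    ... | I₂ , x₂ , e₂ , keep₂ with drain₁ (suc (suc zero)) _ I₂ refl x₂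
    ... | I₃ , x₃ , e₃ , keep₃ =
      I₃ , x₃ , λ { zero → keep₃ zero (keep₂ zero e₁) ; (suc zero) → keep₃ (suc zero) e₂ ; (suc (suc zero)) → e₃ }

  raises : ∀ b → Reached (guess , nil) (stock i 0 0 b 0 0 0 (λ _ → 0) (λ _ → b))
  raises zero    = fires goActive boots (fixed (# 0)) none
  raises (suc b) = fires raise (raises b) (fixed (# 1)) none

  loads : ∀ {b} → (∀ k → i k ≤ b) →
          ∃[ I ] (∃₂ λ X Y → Reached (guess , nil) (stock I 0 0 b 0 0 0 X Y)) × (∀ k → I k ≡ 0)
  loads {b} i≤b = drain (λ I → ∃₂ λ X Y → Reached (guess , nil) (stock I 0 0 b 0 0 0 X Y)) take (_ , _ , raises b)
    where
    room : ∀ {I x y j} → 1 ≤ I → I + x ≡ j → j ≤ b → x + y ≡ b → 1 ≤ y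
    room {I} {x} {y} 1≤I refl I+x≤b refl =
      ≤-trans 1≤I (+-cancelˡ-≤ x I y (subst (_≤ x + y) (+-comm I x) I+x≤b))
    take : ∀ I k → (∃₂ λ X Y → Reached (guess , nil) (stock I 0 0 b 0 0 0 X Y)) → 1 ≤ I k →
           ∃₂ λ X Y → Reached (guess , nil) (stock (λ l → I l ∸ δ³ k l) 0 0 b 0 0 0 X Y)
    take I k (X , Y , v) 1≤ with inv v
    ... | bal , _ , _ , _ , in≡ , _ = _ , _ ,
      fires (load k) v (load∈ k)
        (fits (δ³-δ 1≤) z≤n z≤n z≤n z≤n (λ _ → z≤n) (δ-≤ Y (room 1≤ (in≡ k) (i≤b k) (bal (toℕ k)))))

  allots : ∀ n {I b X Y} → Reached (guess , nil) (stock I 0 0 b 0 0 0 X Y) →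
           Reached (guess , nil) (stock I n 0 b n 0 0 X Y)
  allots zero    v = v
  allots (suc n) v = fires allot (allots n v) (fixed (# 2)) none

  refuels : ∀ w {I n b c X Y} → Reached (guess , nil) (stock I n 0 b c 0 0 X Y) →
            Reached (guess , nil) (stock I n (w + w) b c w 0 X Y)
  refuels zero    v = v
  refuels (suc w) {I} {n} {b} {c} {X} {Y} v =
    subst (λ f → Reached (guess , nil) (stock I n f b c (suc w) 0 X Y)) (cong suc (sym (+-suc w w)))
      (fires refuel (refuels w v) (fixed (# 3)) none)

  honest-run : ∀ {t} → Run p₀ s₀ t →
    ∃[ I ] ∃₂ λ b c → ∃₂ λ X Y →
      (∀ k → I k ≡ 0) × t ≗ X × Reached (run , nil) (stock I 0 0 b c (c * b) 0 X Y)
  honest-run ρ with simulate ρ control₀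
  -- `B` makes room for the run, the sum of the inputs for loading them.
  ... | n , B , sim with loads {B + (i zero + (i (suc zero) + i (suc (suc zero))))} (λ
        { zero             → ≤-trans (m≤m+n _ _) (m≤n+m _ B)
        ; (suc zero)       → ≤-trans (≤-trans (m≤m+n _ _) (m≤n+m _ (i zero))) (m≤n+m _ B)
        ; (suc (suc zero)) → ≤-trans (≤-trans (m≤n+m _ (i (suc zero))) (m≤n+m _ (i zero))) (m≤n+m _ B) })
  ... | I , (X , Y , v) , I≡0 with
        fires launch (subst (λ f → Reached (guess , nil) (stock I n f b n (n * b) 0 X Y)) (sym (*-distribˡ-+ n b b))
                      (refuels (n * b) (allots n v)))
          (fixed (# 4)) none
    where b = B + (i zero + (i (suc zero) + i (suc (suc zero))))
  -- Only the facts on inputs and registers are taken from this invariant; they are the same for any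
  -- volume.
  ... | v′ with inv (refuels (n * 0) (allots n v))
  ... | _ , _ , _ , _ , in≡ , hi≡ with sim (m≤m+n B _) (s₀-loaded I in≡ hi≡ I≡0) v′
  ... | X′ , Y′ , t≗ , v″ = I , _ , n , X′ , Y′ , I≡0 , t≗ , v″

  -- Passive runs: weak multiplication

  hubs : ∀ {n d} → n ∈ names → src p₀ n ≡ (hub , nil) → dst p₀ n ≡ (hub′ , nil) → Fits (pre n) d →
         Reached (hub , nil) d → Reached (hub , nil) (apply n d)
  hubs {n} {d} n∈ s≡ d≡ fit v =
    fires back (subst (λ c → Reached c (apply n d)) d≡
      (fires n (subst (λ c → Reached c d) (sym s≡) v) n∈ fit)) (fixed (# 11)) none

  drops : ∃[ I ] Reached (hub , nil) (stock I 0 0 0 0 0 0 (λ _ → 0) (λ _ → 0)) × (∀ k → I k ≡ 0)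
  drops = drain (λ I → Reached (hub , nil) (stock I 0 0 0 0 0 0 (λ _ → 0) (λ _ → 0)))
    (λ I k v 1≤ → hubs (drop∈ k) refl refl
      (fits (δ³-δ 1≤) z≤n z≤n z≤n z≤n (λ _ → z≤n) (λ _ → z≤n)) v)
    (fires goPassive boots (fixed (# 9)) none)

  module _ {I : Fin 3 → ℕ} where

    at-hub : (b c v s : ℕ) → State → State → Set
    at-hub b c v s X Y = Reached (hub , nil) (stock I 0 0 b c v s X Y)

    bounds : ∀ b {X Y} → at-hub 0 0 0 0 X Y → at-hub b 0 0 0 X Y
    bounds zero    r = r
    bounds (suc b) r = hubs (fixed (# 12)) refl refl none (bounds b r)

    restores : ∀ k {b c v X Y} → at-hub b c v k X Y → at-hub (k + b) c v 0 X Y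
    restores zero    r = r
    restores (suc k) {b} {c} {v} {X} {Y} r =
      subst (λ b → at-hub b c v 0 X Y) (+-suc k b)
        (restores k (hubs (fixed (# 13)) refl refl (fits (λ _ → z≤n) z≤n z≤n z≤n (s≤s z≤n) (λ _ → z≤n) (λ _ → z≤n)) r))

    muls : ∀ k {b c v s X Y} → Reached (mult , nil) (stock I 0 0 (k + b) c v s X Y) →
           Reached (mult , nil) (stock I 0 0 b c (k + v) (k + s) X Y)
    muls zero    r = r
    muls (suc k) {b} {c} {v} {s} {X} {Y} r =
      subst (λ u → Reached (mult , nil) (stock I 0 0 b c (proj₁ u) (proj₂ u) X Y)) (cong₂ _,_ (+-suc k v) (+-suc k s))
        (muls k (fires mulBack (fires mul r (fixed (# 15))
          (fits (λ _ → z≤n) z≤n z≤n (s≤s z≤n) z≤n (λ _ → z≤n) (λ _ → z≤n))) (fixed (# 16)) none))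

    one-round : ∀ k {b c v X Y} → at-hub (k + b) c v 0 X Y → at-hub (k + b) (suc c) (k + v) 0 X Y
    one-round k {b} {c} {v} {X} {Y} r =
      restores k (subst (λ s → at-hub b (suc c) (k + v) s X Y) (+-identityʳ k)
        (fires endRound (muls k (fires round r (fixed (# 14)) none)) (fixed (# 17)) none))

    -- Greedy from the last round: it contributes the minimum of `v` and `b`, and the earlier rounds
    -- the remainder.
    rounds : ∀ c v {b X Y} → v ≤ c * b → at-hub b 0 0 0 X Y → at-hub b c v 0 X Y
    rounds zero    zero _  r = r
    rounds (suc c) v {b} {X} {Y} v≤ r with ≤-total v b
    ... | inj₁ v≤b = subst₂ (λ b v → at-hub b (suc c) v 0 X Y) (m+[n∸m]≡n v≤b) (+-identityʳ v)
      (one-round v (rounds c 0 z≤n (subst (λ b → at-hub b 0 0 0 X Y) (sym (m+[n∸m]≡n v≤b)) r)))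
    ... | inj₂ b≤v = subst₂ (λ b v → at-hub b (suc c) v 0 X Y) (+-identityʳ b) (m+[n∸m]≡n b≤v)
      (one-round b (subst (λ b′ → at-hub b′ c (v ∸ b) 0 X Y) (sym (+-identityʳ b))
        (rounds c (v ∸ b) (≤-trans (∸-monoˡ-≤ b v≤) (≤-reflexive (m+n∸m≡n b (c * b)))) r)))

  module _ (Q : State → Set) (add : ∀ {X} j → j < width → Q X → Q (δ j ∔ X)) (Z : State) where

    pump : ∀ k {j X} → j < width → Q X → ∃[ X′ ] Q X′ × (∀ l → X′ l ≡ k * δ j l + X l)
    pump zero    j< q = _ , q , λ _ → refl
    pump (suc k) {j} {X} j< q with pump k j< (add j j< q)
    ... | X′ , q′ , eq = X′ , q′ , λ l → trans (eq l)
      (trans (sym (+-assoc (k * δ j l) (δ j l) (X l))) (cong (_+ X l) (+-comm (k * δ j l) (δ j l))))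

    -- Used once for registers and once for coregisters: a passive run can imitate whatever an
    -- active run left on these places.
    pumps : ∀ m → m ≤ width → Q (λ _ → 0) →
            ∃[ X ] Q X × (∀ l → l < m → X l ≡ Z l) × (∀ l → m ≤ l → X l ≡ 0)
    pumps zero    m≤ q = _ , q , (λ _ ()) , λ _ _ → refl
    pumps (suc m) m< q with pumps m (<⇒≤ m<) q
    ... | X , qX , low , high with pump (Z m) m< qX
    ... | X′ , qX′ , eq = X′ , qX′ , low′ , high′
      where
      low′ : ∀ l → l < suc m → X′ l ≡ Z l
      low′ l l<1+m with m≤n⇒m<n∨m≡n (≤-pred l<1+m)
      ... | inj₁ l<m  rewrite eq l | δ-> l<m | *-zeroʳ (Z m) = low l l<m
      ... | inj₂ refl rewrite eq m | δ-refl m | high m ≤-refl | *-identityʳ (Z m) = +-identityʳ (Z m)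
      high′ : ∀ l → suc m ≤ l → X′ l ≡ 0
      high′ l m<l rewrite eq l | δ-< m<l | *-zeroʳ (Z m) = high l (<⇒≤ m<l)

  weak-product : ∀ {b c v} → v ≤ c * b → ∀ X Y →
    ∃[ I ] ∃₂ λ X′ Y′ → (∀ k → I k ≡ 0) × (∀ l → l < width → X′ l ≡ X l) × (∀ l → l < width → Y′ l ≡ Y l) ×
      Reached (hub , nil) (stock I 0 0 b c v 0 X′ Y′)
  weak-product {b} {c} {v} v≤ X Y =
    let I , r , I≡0 = drops
        X′ , rX , X′≡ , _ = pumps (λ X → Reached (hub , nil) (stock I 0 0 b c v 0 X (λ _ → 0)))
          (λ j j< → hubs (addReg∈ j<) refl refl none) X width ≤-refl (rounds c v v≤ (bounds b r))
        Y′ , rY , Y′≡ , _ = pumps (λ Y → Reached (hub , nil) (stock I 0 0 b c v 0 X′ Y))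
          (λ j j< → hubs (addCoreg∈ j<) refl refl none) Y width ≤-refl rX
    in I , X′ , Y′ , I≡0 , X′≡ , Y′≡ , rY

-- The Petri net

_≟ₚ_ : DecidableEquality Prog
nil ≟ₚ nil = yes refl
inc r p ≟ₚ inc r′ p′ with r ℕ.≟ r′ | p ≟ₚ p′
... | yes refl | yes refl = yes refl
... | no r≢    | _        = no λ { refl → r≢ refl }
... | _        | no p≢    = no λ { refl → p≢ refl }
while r p q ≟ₚ while r′ p′ q′ with r ℕ.≟ r′ | p ≟ₚ p′ | q ≟ₚ q′
... | yes refl | yes refl | yes refl = yes refl
... | no r≢    | _        | _        = no λ { refl → r≢ refl }
... | _        | no p≢    | _        = no λ { refl → p≢ refl }
... | _        | _        | no q≢    = no λ { refl → q≢ refl }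
nil         ≟ₚ inc _ _     = no λ ()
nil         ≟ₚ while _ _ _ = no λ ()
inc _ _     ≟ₚ nil         = no λ ()
inc _ _     ≟ₚ while _ _ _ = no λ ()
while _ _ _ ≟ₚ nil         = no λ ()
while _ _ _ ≟ₚ inc _ _     = no λ ()

-- Comparison through numbers takes ten cases rather than a hundred.
rank : Phase → ℕ
rank boot   = 0
rank guess  = 1
rank run    = 2
rank swap   = 3
rank unswap = 4
rank hub    = 5
rank hub′   = 6
rank mult   = 7
rank mult′  = 8
rank out    = 9

rank-injective : ∀ x y → rank x ≡ rank y → x ≡ y
rank-injective boot   boot   refl = refl
rank-injective guess  guess  refl = refl
rank-injective run    run    refl = refl
rank-injective swap   swap   refl = refl
rank-injective unswap unswap refl = refl
rank-injective hub    hub    refl = refl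
rank-injective hub′   hub′   refl = refl
rank-injective mult   mult   refl = refl
rank-injective mult′  mult′  refl = refl
rank-injective out    out    refl = refl

_≟ₕ_ : DecidableEquality Phase
x ≟ₕ y with rank x ℕ.≟ rank y
... | yes eq = yes (rank-injective x y eq)
... | no neq = no λ { refl → neq refl }

_≟ᶜ_ : DecidableEquality Ctl
_≟ᶜ_ = ≡-dec _≟ₕ_ _≟ₚ_

mark : Ctl → Ctl → ℕ
mark c c′ = if does (c ≟ᶜ c′) then 1 else 0

mark-refl : ∀ c → mark c c ≡ 1
mark-refl c with c ≟ᶜ c
... | yes _ = refl
... | no c≢c = ⊥-elim (c≢c refl)

mark-≡ : ∀ {c c′} → 1 ≤ mark c c′ → c ≡ c′
mark-≡ {c} {c′} 1≤ with c ≟ᶜ c′ | 1≤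
... | yes eq | _ = eq
... | no _   | ()

-- `boot` counts as active: no transition enters it, so otherwise the initial marking would satisfy
-- `trap` whenever all inputs are 0.
active : Ctl → ℕ
active (boot , _)   = 1
active (guess , _)  = 1
active (run , _)    = 1
active (swap , _)   = 1
active (unswap , _) = 1
active _            = 0

data Item : Set where
  input# : Fin 3 → Item
  tests# fuel# bound# quota# volume# spare# : Item
  reg# coreg# : ℕ → Item

amount : Stock → Item → ℕ
amount d (input# k) = inputs d k
amount d tests#     = tests d
amount d fuel#      = fuel d
amount d bound#     = bound d
amount d quota#     = quota d
amount d volume#    = volume d
amount d spare#     = spare d
amount d (reg# j)   = regs d j
amount d (coreg# j) = coregs d j

data Place : Set where
  item : Item → Place
  ctl  : Ctl → Place
  act  : Place

conf : Ctl → Stock → Place → ℕ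
conf c d (item x) = amount d x
conf c d (ctl c′) = mark c c′
conf c d act      = active c

fits-amount : ∀ {n d} → Fits n d → ∀ x → amount ⌊ n ⌋ x ≤ amount d x
fits-amount fit (input# k) = F.inputs fit k
fits-amount fit tests#     = F.tests fit
fits-amount fit fuel#      = F.fuel fit
fits-amount fit bound#     = F.bound fit
fits-amount fit quota#     = z≤n
fits-amount fit volume#    = z≤n
fits-amount fit spare#     = F.spare fit
fits-amount fit (reg# j)   = F.regs fit j
fits-amount fit (coreg# j) = F.coregs fit j

amount-exchange : ∀ d m p x → amount (exchange d m p) x ≡ amount p x + (amount d x ∸ amount m x)
amount-exchange d m p (input# k) = refl
amount-exchange d m p tests#     = refl
amount-exchange d m p fuel#      = refl
amount-exchange d m p bound#     = refl
amount-exchange d m p quota#     = refl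
amount-exchange d m p volume#    = refl
amount-exchange d m p spare#     = refl
amount-exchange d m p (reg# j)   = refl
amount-exchange d m p (coreg# j) = refl

module _ {k : ℕ} where

  unit : Fin k → Vec ℕ k
  unit i = replicate k 0 [ i ]≔ 1

  unit-enabled : ∀ {i M} → 1 ≤ lookup M i → Enabled (unit i , unit i) M
  unit-enabled {i} {M} 1≤ j with i Fin.≟ j
  ... | yes refl = subst (_≤ lookup M i) (sym (lookup∘update i (replicate k 0) 1)) 1≤
  ... | no i≢j = subst (_≤ lookup M j)
    (sym (trans (lookup∘update′ (i≢j ∘ sym) (replicate k 0) 1) (lookup-replicate j 0))) z≤n

  unit-enabled⁻¹ : ∀ {i M} → Enabled (unit i , unit i) M → 1 ≤ lookup M i
  unit-enabled⁻¹ {i} {M} en = subst (_≤ lookup M i) (lookup∘update i (replicate k 0) 1) (en i)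

fire-neutral : ∀ {k} (u M : Vec ℕ k) → Enabled (u , u) M → fire (u , u) M ≡ M
fire-neutral []      []      en = refl
fire-neutral (x ∷ u) (y ∷ M) en = cong₂ _∷_ (m∸n+n≡m (en zero)) (fire-neutral u M (en ∘ suc))

module _ {A : Set} where

  fire-map : ∀ {k} (f g M : A → ℕ) (xs : Vec A k) →
             fire (map f xs , map g xs) (map M xs) ≡ map (λ x → M x ∸ f x + g x) xs
  fire-map f g M []       = refl
  fire-map f g M (x ∷ xs) = cong (_ ∷_) (fire-map f g M xs)

  map-enabled : ∀ {k} {f g M : A → ℕ} (xs : Vec A k) → (∀ x → f x ≤ M x) → Enabled (map f xs , map g xs) (map M xs)
  map-enabled {f = f} {M = M} xs f≤M i = subst₂ _≤_ (sym (lookup-map i f xs)) (sym (lookup-map i M xs)) (f≤M _)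

  map-enabled⁻¹ : ∀ {k} {f g M : A → ℕ} (xs : Vec A k) → Enabled (map f xs , map g xs) (map M xs) →
                  ∀ {x} → x Vec∈.∈ xs → f x ≤ M x
  map-enabled⁻¹ {f = f} {M = M} xs en x∈ = subst (λ y → f y ≤ M y) (sym (lookup-index x∈))
    (subst₂ _≤_ (lookup-map (index x∈) f xs) (lookup-map (index x∈) M xs) (en (index x∈)))

  map-≡⁻¹ : ∀ {k} {f g : A → ℕ} (xs : Vec A k) → map f xs ≡ map g xs → ∀ {x} → x Vec∈.∈ xs → f x ≡ g x
  map-≡⁻¹ (_ ∷ xs) eq (hereᵛ refl) = cong head eq
  map-≡⁻¹ (_ ∷ xs) eq (thereᵛ x∈) = map-≡⁻¹ xs (cong tail eq) x∈

  map-fromList-cong : ∀ {f g : A → ℕ} {xs} → All (λ x → f x ≡ g x) xs → map f (fromList xs) ≡ map g (fromList xs)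
  map-fromList-cong []         = refl
  map-fromList-cong (eq ∷ eqs) = cong₂ _∷_ eq (map-fromList-cong eqs)

∈⇒≤sum : ∀ {n ns} → n ∈ ns → touch n ≤ sum (mapᴸ touch ns)
∈⇒≤sum {ns = m ∷ ns} (here refl) = m≤m+n _ _
∈⇒≤sum {ns = m ∷ ns} (there n∈)  = ≤-trans (∈⇒≤sum n∈) (m≤n+m _ (touch m))

module Net (p₀ : Prog) (roster : Roster p₀) where

  open Roster roster

  controls : List Ctl
  controls = mapᴸ (src p₀) names ++ mapᴸ (dst p₀) names

  further : List Place
  further = mapᴸ (item ∘ reg#) (upTo width) ++ mapᴸ (item ∘ coreg#) (upTo width) ++ mapᴸ ctl controls

  -- The places on which a token makes a self-loop.
  watched : Vec Place 6
  watched = item (input# zero) ∷ item (input# (suc zero)) ∷ item (input# (suc (suc zero))) ∷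
            act ∷ item tests# ∷ item fuel# ∷ []

  others : List Place
  others = item bound# ∷ item quota# ∷ item volume# ∷ item spare# ∷ further

  places : Vec Place (6 + length others)
  places = watched ++ᵛ fromList others

  ∥_∥ : (Place → ℕ) → Vec ℕ (6 + length others)
  ∥ f ∥ = map f places

  transition : Name → Vec ℕ (6 + length others) × Vec ℕ (6 + length others)
  transition n = ∥ conf (src p₀ n) ⌊ pre n ⌋ ∥ , ∥ conf (dst p₀ n) (post n) ∥

  spot : Fin 6 → Fin (6 + length others)
  spot j = j ↑ˡ length others

  watch : Fin 6 → Vec ℕ (6 + length others) × Vec ℕ (6 + length others)
  watch j = unit (spot j) , unit (spot j)

  transitions : List (Vec ℕ (6 + length others) × Vec ℕ (6 + length others))
  transitions = mapᴸ watch (allFin 6) ++ mapᴸ transition names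

  reg∈ : ∀ {j} → j < width → item (reg# j) Vec∈.∈ places
  reg∈ j< = thereᵛ (thereᵛ (thereᵛ (thereᵛ (thereᵛ (thereᵛ (thereᵛ (thereᵛ (thereᵛ (thereᵛ
    (∈-fromList⁺ (∈-++⁺ˡ (∈-map⁺ (item ∘ reg#) (∈-upTo⁺ j<)))))))))))))

  coreg∈ : ∀ {j} → j < width → item (coreg# j) Vec∈.∈ places
  coreg∈ j< = thereᵛ (thereᵛ (thereᵛ (thereᵛ (thereᵛ (thereᵛ (thereᵛ (thereᵛ (thereᵛ (thereᵛ
    (∈-fromList⁺ (∈-++⁺ʳ (mapᴸ (item ∘ reg#) (upTo width)) (∈-++⁺ˡ (∈-map⁺ (item ∘ coreg#) (∈-upTo⁺ j<))))))))))))))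

  ctl∈ : ∀ {c} → c ∈ controls → ctl c Vec∈.∈ places
  ctl∈ c∈ = thereᵛ (thereᵛ (thereᵛ (thereᵛ (thereᵛ (thereᵛ (thereᵛ (thereᵛ (thereᵛ (thereᵛ
    (∈-fromList⁺ (∈-++⁺ʳ (mapᴸ (item ∘ reg#) (upTo width)) (∈-++⁺ʳ (mapᴸ (item ∘ coreg#) (upTo width)) (∈-map⁺ ctl c∈)))))))))))))

  src∈ : ∀ {n} → n ∈ names → ctl (src p₀ n) Vec∈.∈ places
  src∈ n∈ = ctl∈ (∈-++⁺ˡ (∈-map⁺ (src p₀) n∈))

  dst∈ : ∀ {n} → n ∈ names → ctl (dst p₀ n) Vec∈.∈ places
  dst∈ n∈ = ctl∈ (∈-++⁺ʳ (mapᴸ (src p₀) names) (∈-map⁺ (dst p₀) n∈))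

  conf-apply : ∀ n d → (λ x → conf (src p₀ n) d x ∸ conf (src p₀ n) ⌊ pre n ⌋ x + conf (dst p₀ n) (post n) x) ≗
                       conf (dst p₀ n) (apply n d)
  conf-apply n d (item x) =
    trans (+-comm (amount d x ∸ amount ⌊ pre n ⌋ x) (amount (post n) x)) (sym (amount-exchange d ⌊ pre n ⌋ (post n) x))
  conf-apply n d (ctl c) = cong (_+ mark (dst p₀ n) c) (n∸n≡0 (mark (src p₀ n) c))
  conf-apply n d act     = cong (_+ active (dst p₀ n)) (n∸n≡0 (active (src p₀ n)))

  -- The initial marking without its three input places. It does not depend on the inputs, so one of
  -- them can be its own code.
  boot-rest : Vec ℕ (3 + length others)
  boot-rest = map (conf (boot , nil) empty) (act ∷ item tests# ∷ item fuel# ∷ fromList others)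

  module _ (M₀ : Vec ℕ (6 + length others)) where

    net : PetriNet
    net = record { places = 6 + length others ; trans = transitions ; init = M₀ }

    watch-step : ∀ {M} j → 1 ≤ lookup M (spot j) → Step net M M
    watch-step {M} j 1≤ = Anyₚ.++⁺ˡ (Anyₚ.map⁺ {f = watch} {xs = allFin 6} (lose (∈-allFin j)
      (unit-enabled {i = spot j} {M} 1≤ , sym (fire-neutral (unit (spot j)) M (unit-enabled {i = spot j} {M} 1≤)))))

    name-step : ∀ {n d} → n ∈ names → Fits (pre n) d →
                Step net ∥ conf (src p₀ n) d ∥ ∥ conf (dst p₀ n) (apply n d) ∥
    name-step {n} {d} n∈ fit = Anyₚ.++⁺ʳ (mapᴸ watch (allFin 6)) (Anyₚ.map⁺ {f = transition} {xs = names} (lose n∈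
      (map-enabled {g = conf (dst p₀ n) (post n)} places le ,
       sym (trans (fire-map (conf (src p₀ n) ⌊ pre n ⌋) (conf (dst p₀ n) (post n)) (conf (src p₀ n) d) places)
                  (map-cong (conf-apply n d) places)))))
      where
      le : ∀ x → conf (src p₀ n) ⌊ pre n ⌋ x ≤ conf (src p₀ n) d x
      le (item x) = fits-amount fit x
      le (ctl c)  = ≤-refl
      le act      = ≤-refl

    -- Being enabled tells nothing about registers from `width` on, which are not places; there
    -- `touch<` makes the need 0.
    fits⁻¹ : ∀ {n c d} → n ∈ names →
             (∀ {x} → x Vec∈.∈ places → conf (src p₀ n) ⌊ pre n ⌋ x ≤ conf c d x) → Fits (pre n) d
    fits⁻¹ {n} {c} {d} n∈ le = fits
      (λ { zero → le (hereᵛ refl) ; (suc zero) → le (thereᵛ (hereᵛ refl))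
         ; (suc (suc zero)) → le (thereᵛ (thereᵛ (hereᵛ refl))) })
      (le (thereᵛ (thereᵛ (thereᵛ (thereᵛ (hereᵛ refl))))))
      (le (thereᵛ (thereᵛ (thereᵛ (thereᵛ (thereᵛ (hereᵛ refl)))))))
      (le (thereᵛ (thereᵛ (thereᵛ (thereᵛ (thereᵛ (thereᵛ (hereᵛ refl))))))))
      (le (thereᵛ (thereᵛ (thereᵛ (thereᵛ (thereᵛ (thereᵛ (thereᵛ (thereᵛ (thereᵛ (hereᵛ refl)))))))))))
      (cover (N.reg (pre n)) (m≤m+n _ _) (λ j j< → le (reg∈ j<)))
      (cover (N.coreg (pre n)) (m≤n+m _ (fromMaybe 0 (N.reg (pre n)))) (λ j j< → le (coreg∈ j<)))
      where
      cover : ∀ r {f : State} → fromMaybe 0 r ≤ touch n → (∀ j → j < width → δ? r j ≤ f j) → ∀ j → δ? r j ≤ f j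
      cover nothing  _  _  j = z≤n
      cover (just r) r≤ le j with j <? width
      ... | yes j< = le j j<
      ... | no j≮ = subst (_≤ _) (sym (δ-< (<-≤-trans (≤-<-trans r≤ (touch< n∈)) (≮⇒≥ j≮)))) z≤n

    data StepFrom (c : Ctl) (d : Stock) (M : Vec ℕ (6 + length others)) : Set where
      watched-step : ∀ j → 1 ≤ lookup ∥ conf c d ∥ (spot j) → M ≡ ∥ conf c d ∥ → StepFrom c d M
      named-step   : ∀ n → n ∈ names → src p₀ n ≡ c → Fits (pre n) d →
                     M ≡ ∥ conf (dst p₀ n) (apply n d) ∥ → StepFrom c d M

    -- The control state `c` marks no control place but its own, so an enabled named transition has
    -- source `c`.
    step-from : ∀ {c d M} → Step net ∥ conf c d ∥ M → StepFrom c d M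
    step-from {c} {d} {M} st with Anyₚ.++⁻ (mapᴸ watch (allFin 6)) st
    ... | inj₁ w with find (Anyₚ.map⁻ {f = watch} {xs = allFin 6} w)
    ... | j , _ , en , M≡ = watched-step j (unit-enabled⁻¹ {i = spot j} {∥ conf c d ∥} en)
      (trans M≡ (fire-neutral (unit (spot j)) ∥ conf c d ∥ en))
    step-from {c} {d} {M} st | inj₂ w with find (Anyₚ.map⁻ {f = transition} {xs = names} w)
    ... | n , n∈ , en , M≡ = named-step n n∈ (sym c≡) (fits⁻¹ n∈ le)
      (trans M≡ (trans (fire-map (conf (src p₀ n) ⌊ pre n ⌋) (conf (dst p₀ n) (post n)) (conf c d) places)
        (trans (cong (λ c → map (λ x → conf c d x ∸ conf (src p₀ n) ⌊ pre n ⌋ x + conf (dst p₀ n) (post n) x) places) c≡)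
          (map-cong (conf-apply n d) places))))
      where
      le : ∀ {x} → x Vec∈.∈ places → conf (src p₀ n) ⌊ pre n ⌋ x ≤ conf c d x
      le = map-enabled⁻¹ {g = conf (dst p₀ n) (post n)} places en
      c≡ : c ≡ src p₀ n
      c≡ = mark-≡ (subst (_≤ mark c (src p₀ n)) (mark-refl (src p₀ n)) (le (src∈ n∈)))

-- The formula

-- A negated existential instead of a universal disjunction: constructively, nobody has to decide
-- which markings carry a self-loop.
trap : Formula
trap = ∃' zero ∙ ((¬' edge zero zero) ∧' (¬' (∃' suc zero ∙ (edge (suc zero) zero ∧' (¬' edge (suc zero) (suc zero))))))

module _ {p₀ : Prog} where

  passive-moves : ∀ n → active (src p₀ n) ≡ 0 → dst p₀ n ≢ src p₀ n
  passive-moves goActive ()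
  passive-moves raise ()
  passive-moves allot ()
  passive-moves refuel ()
  passive-moves launch ()
  passive-moves accept ()
  passive-moves (load _) ()
  passive-moves (inc _ _) ()
  passive-moves (iter _ _ _) ()
  passive-moves (enter _ _ _) ()
  passive-moves (swap _ _ _) ()
  passive-moves (turn _ _ _) ()
  passive-moves (unswap _ _ _) ()
  passive-moves (leave _ _ _) ()
  passive-moves goPassive ()
  passive-moves rest _ ()
  passive-moves back _ ()
  passive-moves addBound _ ()
  passive-moves restore _ ()
  passive-moves round _ ()
  passive-moves mul _ ()
  passive-moves mulBack _ ()
  passive-moves endRound _ ()
  passive-moves halt _ ()
  passive-moves (drop _) _ ()
  passive-moves (addReg _) _ ()
  passive-moves (addCoreg _) _ ()

  into-out : ∀ n → dst p₀ n ≡ (out , nil) → n ≡ accept ⊎ n ≡ halt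
  into-out accept _ = inj₁ refl
  into-out halt   _ = inj₂ refl
  into-out goActive ()
  into-out raise ()
  into-out allot ()
  into-out refuel ()
  into-out launch ()
  into-out (load _) ()
  into-out (inc _ _) ()
  into-out (iter _ _ _) ()
  into-out (enter _ _ _) ()
  into-out (swap _ _ _) ()
  into-out (turn _ _ _) ()
  into-out (unswap _ _ _) ()
  into-out (leave _ _ _) ()
  into-out goPassive ()
  into-out rest ()
  into-out back ()
  into-out addBound ()
  into-out restore ()
  into-out round ()
  into-out mul ()
  into-out mulBack ()
  into-out endRound ()
  into-out (drop _) ()
  into-out (addReg _) ()
  into-out (addCoreg _) ()

-- Satisfaction of the formula and the outcome of the program

record Quiet (d : Stock) : Set where
  constructor quiet
  field
    no-inputs : ∀ k → inputs d k ≡ 0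
    no-tests  : tests d ≡ 0
    no-fuel   : fuel d ≡ 0

module Trap (p₀ : Prog) (i : Fin 3 → ℕ) (roster : Roster p₀) where

  open Roster roster
  open VASS p₀ i names
  open Simulation p₀ i roster
  open Net p₀ roster

  further-agrees : ∀ {c d d′} → (∀ j → j < width → regs d j ≡ regs d′ j) → (∀ j → j < width → coregs d j ≡ coregs d′ j) →
                   All (λ x → conf c d x ≡ conf c d′ x) further
  further-agrees X≡ Y≡ = Allₚ.++⁺ (Allₚ.map⁺ (All.map (X≡ _) (Allₚ.all-upTo width)))
    (Allₚ.++⁺ (Allₚ.map⁺ (All.map (Y≡ _) (Allₚ.all-upTo width))) (Allₚ.map⁺ (All.universal (λ _ → refl) controls)))

  N : PetriNet
  N = net (i zero ∷ i (suc zero) ∷ i (suc (suc zero)) ∷ boot-rest)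

  init≡ : PetriNet.init N ≡ ∥ conf (boot , nil) start ∥
  init≡ = cong (λ v → i zero ∷ i (suc zero) ∷ i (suc (suc zero)) ∷ 1 ∷ 0 ∷ 0 ∷ 0 ∷ 0 ∷ 0 ∷ 0 ∷ v)
    (map-fromList-cong (further-agrees {boot , nil} {empty} {start} (λ _ _ → refl) (λ _ _ → refl)))

  complete : ∀ {c d} → Reached c d → Reachable N ∥ conf c d ∥
  complete boots              = subst (Reachable N) init≡ here
  complete (fires n v n∈ fit) = step (complete v) (name-step (PetriNet.init N) n∈ fit)

  sound : ∀ {M} → Reachable N M → ∃₂ λ c d → M ≡ ∥ conf c d ∥ × Reached c d
  sound here = _ , _ , init≡ , boots
  sound (step {M} {M′} r st) = extend (sound r) st
    where
    extend : (∃₂ λ c d → M ≡ ∥ conf c d ∥ × Reached c d) → Step N M M′ → ∃₂ λ c d → M′ ≡ ∥ conf c d ∥ × Reached c d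
    extend (c , d , refl , v) st = next (step-from (PetriNet.init N) st)
      where
      next : StepFrom (PetriNet.init N) c d M′ → ∃₂ λ c d → M′ ≡ ∥ conf c d ∥ × Reached c d
      next (watched-step j _ M′≡)         = c , d , M′≡ , v
      next (named-step n n∈ refl fit M′≡) = _ , _ , M′≡ , fires n v n∈ fit

  -- No watched place has a token, and a passive transition moves the control token elsewhere. With
  -- its converse `quiet⁻¹` this characterises the reachable markings without a self-loop.
  idle : ∀ {c d} → active c ≡ 0 → Quiet d → ¬ Step N ∥ conf c d ∥ ∥ conf c d ∥
  idle {c} {d} c≡0 (quiet I≡0 t≡0 f≡0) st = idle′ (step-from (PetriNet.init N) st)
    where
    zeros : ∀ j → lookup ∥ conf c d ∥ (spot j) ≡ 0
    zeros zero                               = I≡0 zero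
    zeros (suc zero)                         = I≡0 (suc zero)
    zeros (suc (suc zero))                   = I≡0 (suc (suc zero))
    zeros (suc (suc (suc zero)))             = c≡0
    zeros (suc (suc (suc (suc zero))))       = t≡0
    zeros (suc (suc (suc (suc (suc zero))))) = f≡0
    idle′ : StepFrom (PetriNet.init N) c d ∥ conf c d ∥ → ⊥
    idle′ (watched-step j 1≤ _)           = <-irrefl (sym (zeros j)) 1≤
    idle′ (named-step n n∈ refl fit M≡) = passive-moves n c≡0
      (mark-≡ (subst (1 ≤_) (trans (sym (mark-refl (src p₀ n))) (map-≡⁻¹ places M≡ (src∈ n∈))) (s≤s z≤n)))

  quiet⁻¹ : ∀ {c d} → ¬ Step N ∥ conf c d ∥ ∥ conf c d ∥ → active c ≡ 0 × Quiet d
  quiet⁻¹ {c} {d} ¬st = zeros (suc (suc (suc zero))) ,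
    quiet (λ { zero → zeros zero ; (suc zero) → zeros (suc zero) ; (suc (suc zero)) → zeros (suc (suc zero)) })
      (zeros (suc (suc (suc (suc zero))))) (zeros (suc (suc (suc (suc (suc zero))))))
    where
    zeros : ∀ j → lookup ∥ conf c d ∥ (spot j) ≡ 0
    zeros j = n<1⇒n≡0 (≰⇒> (¬st ∘ watch-step (PetriNet.init N) j))

  -- The witness is the end of an honest run with volume `c * b` before `accept`. It can be entered
  -- from an active marking, which has a self-loop, or by `halt`, which the passive invariant
  -- forbids.
  accepting : ∀ {t} → Run p₀ s₀ t → t 3 ≡ 1 → N ⊨ trap
  accepting {t} ρ t≡1 = result (honest-run ρ)
    where
    result : (∃[ I ] ∃₂ λ b c → ∃₂ λ X Y →
               (∀ k → I k ≡ 0) × t ≗ X × Reached (run , nil) (stock I 0 0 b c (c * b) 0 X Y)) → N ⊨ trap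
    result (I , b , c , X , Y , I≡0 , t≗X , v) =
      (∥ conf (out , nil) e ∥ , complete (fires accept v (fixed (# 5)) fit)) ,
      idle refl (quiet I≡0 refl refl) ,
      λ ((M , r) , st , ¬loop) → only-from-active (sound r) st ¬loop
      where
      e : Stock
      e = apply accept (stock I 0 0 b c (c * b) 0 X Y)
      fit : Fits (pre accept) (stock I 0 0 b c (c * b) 0 X Y)
      fit = fits (λ _ → z≤n) z≤n z≤n z≤n z≤n (δ-≤ X (subst (1 ≤_) (trans (sym t≡1) (t≗X 3)) (s≤s z≤n))) (λ _ → z≤n)
      only-from-active : ∀ {M} → (∃₂ λ c d → M ≡ ∥ conf c d ∥ × Reached c d) →
                         Step N M ∥ conf (out , nil) e ∥ → ¬ Step N M M → ⊥
      only-from-active (c′ , d , refl , v′) st ¬loop = from (step-from (PetriNet.init N) st)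
        where
        by-name : ∀ {n} → n ≡ accept ⊎ n ≡ halt → src p₀ n ≡ c′ →
                  ∥ conf (out , nil) e ∥ ≡ ∥ conf (dst p₀ n) (apply n d) ∥ → ⊥
        by-name (inj₁ refl) refl eq = 0≢1+n (sym (proj₁ (quiet⁻¹ ¬loop)))
        -- `accept` raised the volume to `suc (c * b)`, one more than a passive run attains.
        by-name (inj₂ refl) refl eq = <-irrefl refl (≤-trans (≤-reflexive v≡) (≤-trans (inv v′) (≤-reflexive b≡)))
          where
          at : ∀ {x} → x Vec∈.∈ places → conf (out , nil) e x ≡ conf (out , nil) d x
          at = map-≡⁻¹ places eq
          v≡ : suc (c * b) ≡ volume d
          v≡ = at (thereᵛ (thereᵛ (thereᵛ (thereᵛ (thereᵛ (thereᵛ (thereᵛ (thereᵛ (hereᵛ refl)))))))))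
          b≡ : quota d * (bound d + spare d) ≡ c * b
          b≡ = sym (cong₂ _*_
            (at (thereᵛ (thereᵛ (thereᵛ (thereᵛ (thereᵛ (thereᵛ (thereᵛ (hereᵛ refl)))))))))
            (trans (sym (+-identityʳ b)) (cong₂ _+_
              (at (thereᵛ (thereᵛ (thereᵛ (thereᵛ (thereᵛ (thereᵛ (hereᵛ refl))))))))
              (at (thereᵛ (thereᵛ (thereᵛ (thereᵛ (thereᵛ (thereᵛ (thereᵛ (thereᵛ (thereᵛ (hereᵛ refl))))))))))))))
        from : StepFrom (PetriNet.init N) c′ d ∥ conf (out , nil) e ∥ → ⊥
        from (watched-step j 1≤ _) = ¬loop (watch-step (PetriNet.init N) j 1≤)
        from (named-step n n∈ s≡ _ eq) = by-name (into-out n (sym (mark-≡ (subst (1 ≤_)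
          (trans (sym (mark-refl (dst p₀ n))) (sym (map-≡⁻¹ places eq (dst∈ n∈)))) (s≤s z≤n))))) s≡ eq

  NoPassivePred : Ctl → Stock → Set
  NoPassivePred c e = ¬ (Σ (Reach N) λ x → Step N (proj₁ x) ∥ conf c e ∥ × ¬ Step N (proj₁ x) (proj₁ x))

  passive-pred : ∀ {n d c e} → n ∈ names → Fits (pre n) d → Reached (src p₀ n) d → active (src p₀ n) ≡ 0 → Quiet d →
                 ∥ conf (dst p₀ n) (apply n d) ∥ ≡ ∥ conf c e ∥ → ¬ NoPassivePred c e
  passive-pred {n} {d} n∈ fit v a≡0 q eq ¬pred = ¬pred ((_ , complete v) ,
    subst (Step N ∥ conf (src p₀ n) d ∥) eq (name-step (PetriNet.init N) n∈ fit) , idle a≡0 q)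

  -- `rest` and `back` make the `hub` and `hub′` markings of the same stock predecessors of each
  -- other.
  hub-pred : ∀ {e} → Reached (hub , nil) e → Quiet e → ¬ NoPassivePred (hub , nil) e
  hub-pred v q = passive-pred {back} (fixed (# 11)) none (fires rest v (fixed (# 10)) none) refl q refl

  hub′-pred : ∀ {e} → Reached (hub′ , nil) e → Quiet e → ¬ NoPassivePred (hub′ , nil) e
  hub′-pred v q = passive-pred {rest} (fixed (# 10)) none (fires back v (fixed (# 11)) none) refl q refl

  module _ {t} (ρ : Run p₀ s₀ t) (t≡0 : t 3 ≡ 0) where

    -- If the guesses were fair, using up all tests and fuel proves the run honest, and determinism
    -- contradicts the token in register 3. Otherwise the volume is below quota times bound, so even
    -- after `accept` it is within reach of a passive run, which enters the same marking by `halt`.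
    out-pred : ∀ {d} → Reached (run , nil) d → Fits (pre accept) d → Quiet d → ¬ NoPassivePred (out , nil) (apply accept d)
    out-pred {d} v fit (quiet I≡0 t≡ f≡) ¬pred = compare (quota d * bound d ≤? volume d)
      where
      compare : Dec (quota d * bound d ≤ volume d) → ⊥
      compare (yes fair) = <-irrefl (sym (trans (sym (s≗ 3)) (trans (Run-deterministic (λ _ → refl) (hon s nil) ρ 3) t≡0)))
                                    (F.regs fit 3)
        where
        honest : Honest nil (regs d)
        honest = proj₂ (proj₂ (proj₂ (inv v)) (I≡0 , fair))
          (trans f≡ (sym (trans (+-identityʳ _) (cong (_* (bound d + bound d)) t≡))))
        s = proj₁ honest
        s≗ = proj₁ (proj₂ honest)
        hon = proj₂ (proj₂ honest)
      compare (no cheat) =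
        let I , X , Y , I≡0′ , X≡ , Y≡ , u = weak-product (≰⇒> cheat) (regs (apply accept d)) (coregs (apply accept d)) in
        passive-pred {halt} (fixed (# 18)) none u refl (quiet I≡0′ refl refl) (same I X Y I≡0′ X≡ Y≡) ¬pred
        where
        same : ∀ I X Y → (∀ k → I k ≡ 0) → (∀ l → l < width → X l ≡ regs (apply accept d) l) →
               (∀ l → l < width → Y l ≡ coregs (apply accept d) l) →
               ∥ conf (out , nil) (stock I 0 0 (bound d) (quota d) (suc (volume d)) 0 X Y) ∥ ≡
               ∥ conf (out , nil) (apply accept d) ∥
        same I X Y I≡0′ X≡ Y≡ =
          I≡ zero ∷≡ I≡ (suc zero) ∷≡ I≡ (suc (suc zero)) ∷≡ refl ∷≡ sym t≡ ∷≡ sym f≡ ∷≡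
          refl ∷≡ refl ∷≡ refl ∷≡ sym (proj₁ (proj₂ (inv v))) ∷≡
          map-fromList-cong (further-agrees {out , nil} {stock I 0 0 (bound d) (quota d) (suc (volume d)) 0 X Y}
            {apply accept d} X≡ Y≡)
          where
          infixr 5 _∷≡_
          _∷≡_ : ∀ {k x y} {xs ys : Vec ℕ k} → x ≡ y → xs ≡ ys → x ∷ xs ≡ y ∷ ys
          _∷≡_ = cong₂ _∷_
          I≡ : ∀ k → I k ≡ inputs d k
          I≡ k = trans (I≡0′ k) (sym (I≡0 k))

    no-trap : ∀ {c e} → Reached c e → active c ≡ 0 → Quiet e → ¬ NoPassivePred c e
    no-trap boots ()
    no-trap (fires goActive _ _ _) ()
    no-trap (fires raise _ _ _) ()
    no-trap (fires allot _ _ _) ()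
    no-trap (fires refuel _ _ _) ()
    no-trap (fires launch _ _ _) ()
    no-trap (fires (load _) _ _ _) ()
    no-trap (fires (inc _ _) _ _ _) ()
    no-trap (fires (iter _ _ _) _ _ _) ()
    no-trap (fires (enter _ _ _) _ _ _) ()
    no-trap (fires (swap _ _ _) _ _ _) ()
    no-trap (fires (turn _ _ _) _ _ _) ()
    no-trap (fires (unswap _ _ _) _ _ _) ()
    no-trap (fires (leave _ _ _) _ _ _) ()
    -- Rebuilding `quiet` retypes its fields for the stock before the transition, whose inputs,
    -- tests and fuel are definitionally the same.
    no-trap (fires accept v _ fit)         _ (quiet a b c)  = out-pred v fit (quiet a b c)
    -- The marking just left may have a self-loop: `boot` is active, and `drop` starts with an input
    -- present. Resting at the hub supplies another predecessor.
    no-trap v@(fires goPassive _ _ _)      _ q              = hub-pred v q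
    no-trap v@(fires back _ _ _)           _ q              = hub-pred v q
    no-trap v@(fires endRound _ _ _)       _ q              = hub-pred v q
    no-trap v@(fires rest _ _ _)           _ q              = hub′-pred v q
    no-trap v@(fires addBound _ _ _)       _ q              = hub′-pred v q
    no-trap v@(fires restore _ _ _)        _ q              = hub′-pred v q
    no-trap v@(fires (drop _) _ _ _)       _ q              = hub′-pred v q
    no-trap v@(fires (addReg _) _ _ _)     _ q              = hub′-pred v q
    no-trap v@(fires (addCoreg _) _ _ _)   _ q              = hub′-pred v q
    no-trap (fires round v n∈ fit)         _ (quiet a b c)  = passive-pred {round} n∈ fit v refl (quiet a b c) refl
    no-trap (fires mul v n∈ fit)           _ (quiet a b c)  = passive-pred {mul} n∈ fit v refl (quiet a b c) refl
    no-trap (fires mulBack v n∈ fit)       _ (quiet a b c)  = passive-pred {mulBack} n∈ fit v refl (quiet a b c) refl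
    no-trap (fires halt v n∈ fit)          _ (quiet a b c)  = passive-pred {halt} n∈ fit v refl (quiet a b c) refl

    rejecting : ¬ (N ⊨ trap)
    rejecting ((M , r) , ¬loop , ¬pred) = refute (sound r) ¬loop ¬pred
      where
      refute : (∃₂ λ c d → M ≡ ∥ conf c d ∥ × Reached c d) → ¬ Step N M M →
               ¬ (Σ (Reach N) λ x → Step N (proj₁ x) M × ¬ Step N (proj₁ x) (proj₁ x)) → ⊥
      refute (c , e , refl , v) ¬loop ¬pred = no-trap v (proj₁ (quiet⁻¹ ¬loop)) (proj₂ (quiet⁻¹ ¬loop)) ¬pred

-- Self-reference

module Names (p₀ : Prog) where

  coreNames names : List Name
  coreNames = fixedNames ++ concatMap nodeNames (nodes p₀ nil)

  width : ℕ
  width = 4 + sum (mapᴸ touch coreNames)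

  names = coreNames ++ mapᴸ addReg (upTo width) ++ mapᴸ addCoreg (upTo width)

  touch< : ∀ {n} → n ∈ names → touch n < width
  touch< n∈ with ∈-++⁻ coreNames n∈
  ... | inj₁ core = s≤s (≤-trans (∈⇒≤sum core) (m≤n+m _ 3))
  ... | inj₂ n∈′ with ∈-++⁻ (mapᴸ addReg (upTo width)) n∈′
  ... | inj₁ add with ∈-map⁻ addReg add
  ... | j , _ , refl = s≤s z≤n
  touch< n∈ | inj₂ n∈′ | inj₂ add with ∈-map⁻ addCoreg add
  ... | j , _ , refl = s≤s z≤n

  roster : Roster p₀
  roster = record
    { names     = names
    ; width     = width
    ; fixed∈    = λ n∈ → ∈-++⁺ˡ {xs = coreNames} (∈-++⁺ˡ n∈)
    ; node∈     = λ p∈ n∈ → ∈-++⁺ˡ {xs = coreNames} (∈-++⁺ʳ fixedNames (∈-concatMap⁺ nodeNames (lose p∈ n∈)))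
    ; addReg∈   = λ j< → ∈-++⁺ʳ coreNames (∈-++⁺ˡ (∈-map⁺ addReg (∈-upTo⁺ j<)))
    ; addCoreg∈ = λ j< → ∈-++⁺ʳ coreNames (∈-++⁺ʳ (mapᴸ addReg (upTo width)) (∈-map⁺ addCoreg (∈-upTo⁺ j<)))
    ; touch<    = touch<
    }

-- Computing the code of a net from its inputs

private variable
  xs : Vec ℕ n

addP : PR 2
addP = prec (proj zero) (comp succF (proj (suc zero) ∷ []))

addP-eval : ∀ x y → Eval addP (x ∷ y ∷ []) (x + y)
addP-eval zero    y = prec0 projE
addP-eval (suc x) y = precS (addP-eval x y) (compE (projE ∷ []) succE)

triP : PR 1
triP = prec zeroF (comp addP (comp succF (proj zero ∷ []) ∷ proj (suc zero) ∷ []))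

triP-eval : ∀ x → Eval triP (x ∷ []) (tri x)
triP-eval zero    = prec0 zeroE
triP-eval (suc x) = precS (triP-eval x) (compE (compE (projE ∷ []) succE ∷ projE ∷ []) (addP-eval (suc x) (tri x)))

pairP : PR n → PR n → PR n
pairP f g = comp addP (comp triP (comp addP (f ∷ g ∷ []) ∷ []) ∷ g ∷ [])

pairP-eval : ∀ {f g : PR n} {x y} → Eval f xs x → Eval g xs y → Eval (pairP f g) xs (pair x y)
pairP-eval {x = x} {y} ef eg =
  compE (compE (compE (ef ∷ eg ∷ []) (addP-eval x y) ∷ []) (triP-eval (x + y)) ∷ eg ∷ []) (addP-eval (tri (x + y)) y)

sucP : PR n → PR n
sucP f = comp succF (f ∷ [])

sucP-eval : ∀ {f : PR n} {x} → Eval f xs x → Eval (sucP f) xs (suc x)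
sucP-eval ef = compE (ef ∷ []) succE

-- The code of a net with p places, transitions coded by t and initial marking p ∷ t ∷ v ∷ M, where v codes M.
self : PR 3
self = pairP #p (pairP #t (sucP (pairP #p (sucP (pairP #t (sucP (pairP #v #v)))))))
  where
  #p #t #v : PR 3
  #p = proj zero
  #t = proj (suc zero)
  #v = proj (suc (suc zero))

-- The inputs are in registers 0, 1, 2 and the output in register 3, so the stack lists the inputs backwards.
program : PR 3 → Prog
program f = code-PR {h = 3} f (suc (suc zero) ∷ suc zero ∷ zero ∷ [])

simulates : (f : PR 3) (i : Fin 3 → ℕ) (roster : Roster (program f)) →
            (Eval f (i zero ∷ i (suc zero) ∷ i (suc (suc zero)) ∷ []) 1 → Trap.N (program f) i roster ⊨ trap) ×
            (Eval f (i zero ∷ i (suc zero) ∷ i (suc (suc zero)) ∷ []) 0 → ¬ (Trap.N (program f) i roster ⊨ trap))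
simulates f i roster =
  (λ ev → let _ , t≗ , ρ = runs ev in accepting ρ (trans (t≗ 3) (get-cell (1 ∷ inputs₃) zero))) ,
  (λ ev → let _ , t≗ , ρ = runs ev in rejecting ρ (trans (t≗ 3) (get-cell (0 ∷ inputs₃) zero)))
  where
  open Trap (program f) i roster
  inputs₃ : Vec ℕ 3
  inputs₃ = i (suc (suc zero)) ∷ i (suc zero) ∷ i zero ∷ []
  runs : ∀ {y} → Eval f (i zero ∷ i (suc zero) ∷ i (suc (suc zero)) ∷ []) y →
         ∃[ t ] t ≗ get (y ∷ inputs₃) × Run (program f) (get inputs₃) t
  runs ev = Exec.executes (code-PR-x f {st = inputs₃} (suc (suc zero) ∷ suc zero ∷ zero ∷ []) refl ev) (λ _ → refl)

codeInit : List (Vec ℕ (3 + n) × Vec ℕ (3 + n)) → Vec ℕ n → Fin 3 → ℕ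
codeInit {n} ts M zero             = 3 + n
codeInit {n} ts M (suc zero)       = codeTrans ts
codeInit {n} ts M (suc (suc zero)) = codeVec M

withInit : List (Vec ℕ (3 + n) × Vec ℕ (3 + n)) → Vec ℕ n → (Fin 3 → ℕ) → PetriNet
withInit {n} ts M i = record { places = 3 + n ; trans = ts ; init = i zero ∷ i (suc zero) ∷ i (suc (suc zero)) ∷ M }

self-eval : ∀ ts (M : Vec ℕ n) → let i = codeInit ts M in
            Eval self (i zero ∷ i (suc zero) ∷ i (suc (suc zero)) ∷ []) (codeNet (withInit ts M i))
self-eval ts M =
  pairP-eval projE (pairP-eval projE (sucP-eval (pairP-eval projE (sucP-eval (pairP-eval projE (sucP-eval (pairP-eval projE projE)))))))

Simulates : PR 3 → ((Fin 3 → ℕ) → PetriNet) → Set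
Simulates f N = ∀ i → let xs = i zero ∷ i (suc zero) ∷ i (suc (suc zero)) ∷ [] in
  (Eval f xs 1 → N i ⊨ trap) × (Eval f xs 0 → ¬ (N i ⊨ trap))

-- The fixed point: on inputs coding the other parts of the net, `self` returns the code of the
-- whole net, so the simulated program returns the verdict of `c` on the very net simulating it.
-- Transitions and marking are kept abstract to prevent their unfolding.
at-own-code : (c : PR 1) (ts : List (Vec ℕ (3 + n) × Vec ℕ (3 + n))) (M : Vec ℕ n) → Simulates (comp c (self ∷ [])) (withInit ts M) →
       Σ PetriNet λ N → (Eval c (codeNet N ∷ []) 1 → N ⊨ trap) × (Eval c (codeNet N ∷ []) 0 → ¬ (N ⊨ trap))
at-own-code c ts M sim = withInit ts M (codeInit ts M) ,
  (λ ev → proj₁ (sim (codeInit ts M)) (compE (self-eval ts M ∷ []) ev)) ,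
  (λ ev → proj₂ (sim (codeInit ts M)) (compE (self-eval ts M ∷ []) ev))

adversary : (c : PR 1) → Roster (program (comp c (self ∷ []))) →
             Σ PetriNet λ N → (Eval c (codeNet N ∷ []) 1 → N ⊨ trap) × (Eval c (codeNet N ∷ []) 0 → ¬ (N ⊨ trap))
-- `Trap.N` is by definition `withInit transitions boot-rest i`, as neither component depends on
-- `i`.
adversary c roster = at-own-code c transitions boot-rest (λ i → simulates (comp c (self ∷ [])) i roster)
  where open Net (program (comp c (self ∷ []))) roster

-- The negation turns the fixed point into a diagonal argument: the answer 1 denies a trap but
-- creates one. A doubly negated trap already forces the answer 0, hence no case distinction on the
-- truth of the sentence is made.
theorem3p3 : Σ Formula λ φ → Sentence φ × ¬ DecidableNetProperty (λ N → N ⊨ φ)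
theorem3p3 = ¬' trap , neg (ex (and (neg (edge refl refl)) (neg (ex (and (edge refl refl) (neg (edge refl refl))))))) ,
  λ (c , decides) →
    let N , accepts , rejects = adversary c (Names.roster _)
        yes⇒1 , no⇒0 = decides N
        trapped = λ ¬trap → ¬trap (accepts (yes⇒1 ¬trap))
    in trapped (rejects (no⇒0 trapped))
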